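{- Let $n\ge1$ be an integer and $r\ge1$ a real number such that $rn$ is an integer. Then (a) $(n,n,rn)\xrightarrow{\textsc{bm}}\left\lceil\dfrac{\lfloor 2r\rfloor n}{\lfloor 2r\rfloor+2}\right\rceil$, and (b) $(n,n,rn)\xrightarrow{\textsc{bm}}\left\lceil\dfrac{2rn}{\lceil 2r\rceil+2}\right\rceil$.
   Context: A hypergraph is identified with its finite edge set; a matching is a set of pairwise disjoint edges. A hypergraph $H$ is $k$-partite with sides $V_1,\ldots,V_k$ (a fixed partition of its vertex set) if $|e\cap V_t|=1$ for every edge $e$ and every $t$. For $f:H\to\mathbb{R}_{\ge0}$, $\deg_f(v)=\sum_{e\ni v}f(e)$; $f$ is balanced if $\deg_f$ is constant on each side. $H$ is $(b_1,\ldots,b_k)$-fractionally balanced if it is $k$-partite with sides of sizes $b_1,\ldots,b_k$ and has a nonzero balanced $f:H\to\mathbb{R}_{\ge0}$. $(b_1,\ldots,b_k)\xrightarrow{\textsc{bm}} m$ means every $(b_1,\ldots,b_k)$-fractionally balanced $k$-partite hypergraph has a matching of size $m$.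
   Formalization: The balanced weight function f takes nonnegative rational values instead of nonnegative real ones; since balance is a homogeneous linear system with integer coefficients, a nonzero nonnegative real solution exists exactly when a rational one does. -}

module Defs where

open import Data.Nat as ℕ using (ℕ; zero; suc; _∸_; NonZero)
open import Data.Nat.DivMod using (_/_)
open import Data.Fin using (Fin; zero; suc)
open import Data.Bool using (Bool; true; false)
open import Data.Rational as ℚ using (ℚ; 0ℚ)
open import Data.Product using (Σ; ∃; _×_; _,_)
open import Function.Definitions using (Injective)
open import Relation.Binary.PropositionalEquality using (_≡_; _≢_)

Σℚ : (n : ℕ) → (Fin n → ℚ) → ℚ
Σℚ zero    g = 0ℚ
Σℚ (suc n) g = g zero ℚ.+ Σℚ n (λ i → g (suc i))

-- A 3-partite hypergraph with sides V₁ = Fin a, V₂ = Fin b, V₃ = Fin c.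
-- Every edge meets each side in exactly one vertex, so an edge is a triple
-- (i , j , k); the hypergraph is its edge set, given as a decidable subset.
Hyp3 : ℕ → ℕ → ℕ → Set
Hyp3 a b c = Fin a → Fin b → Fin c → Bool

-- Weight functions f : H → ℚ≥0, represented on all triples and vanishing off H.
Weight : ℕ → ℕ → ℕ → Set
Weight a b c = Fin a → Fin b → Fin c → ℚ

module _ {a b c : ℕ} where

  deg₁ : Weight a b c → Fin a → ℚ
  deg₁ f i = Σℚ b (λ j → Σℚ c (λ k → f i j k))

  deg₂ : Weight a b c → Fin b → ℚ
  deg₂ f j = Σℚ a (λ i → Σℚ c (λ k → f i j k))

  deg₃ : Weight a b c → Fin c → ℚ
  deg₃ f k = Σℚ a (λ i → Σℚ b (λ j → f i j k))

  IsWeightOn : Hyp3 a b c → Weight a b c → Set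
  IsWeightOn H f = (∀ i j k → 0ℚ ℚ.≤ f i j k)
                 × (∀ i j k → H i j k ≡ false → f i j k ≡ 0ℚ)

  Balanced : Weight a b c → Set
  Balanced f = (∀ i i' → deg₁ f i ≡ deg₁ f i')
             × (∀ j j' → deg₂ f j ≡ deg₂ f j')
             × (∀ k k' → deg₃ f k ≡ deg₃ f k')

  NonZeroW : Weight a b c → Set
  NonZeroW f = ∃ λ i → ∃ λ j → ∃ λ k → f i j k ≢ 0ℚ

  FracBalanced : Hyp3 a b c → Set
  FracBalanced H = Σ (Weight a b c) λ f → IsWeightOn H f × Balanced f × NonZeroW f

  -- H has a matching of size s: s edges (σ t , τ t , ρ t), t : Fin s,
  -- pairwise disjoint (i.e. σ, τ, ρ injective).
  HasMatching : Hyp3 a b c → ℕ → Set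
  HasMatching H s =
    Σ (Fin s → Fin a) λ σ → Σ (Fin s → Fin b) λ τ → Σ (Fin s → Fin c) λ ρ →
      Injective _≡_ _≡_ σ × Injective _≡_ _≡_ τ × Injective _≡_ _≡_ ρ ×
      (∀ t → H (σ t) (τ t) (ρ t) ≡ true)

BM : ℕ → ℕ → ℕ → ℕ → Set
BM a b c s = (H : Hyp3 a b c) → FracBalanced H → HasMatching H s

⌈_/_⌉ : (x y : ℕ) → .{{NonZero y}} → ℕ
⌈ x / y ⌉ = (x ℕ.+ y ∸ 1) / y

-- With r = m / n (m = rn):  ⌊2r⌋ = ⌊2m/n⌋ , ⌈2r⌉ = ⌈2m/n⌉
floor2r : (n m : ℕ) → .{{NonZero n}} → ℕ
floor2r n m = (2 ℕ.* m) / n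

ceil2r : (n m : ℕ) → .{{NonZero n}} → ℕ
ceil2r n m = ⌈ 2 ℕ.* m / n ⌉

{-# OPTIONS --safe #-}
module Submission where

-- Write V₁, V₂, V₃ for the sides (sizes n, n, m) and view V₁ as a set of colours: an edge is a
-- coloured edge of a bipartite multigraph between V₂ and V₃, and a matching is a rainbow one.
-- By the topological Hall theorem, a rainbow matching of size n - d exists if for every set K of
-- colours the complex of matchings among the edges with colours in K has no homology in
-- dimensions up to |K| - d - 2.  After scaling, the balanced weight gives those edges total
-- weight |K| α, with weight at most α at each vertex of V₂ and at most β at each vertex of V₃,
-- where m β = n α.  Meshulam's deletion/explosion argument bounds the connectivity below by
-- (total weight) / (α + β), provided that the edge e on which it is played is a leaf of the
-- support; cancelling alternating cycles in the support always produces a leaf.  This gives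
-- ⌈mn / (m + n)⌉, which is at least both of the claimed bounds.

open import Defs
open import Data.Nat using (ℕ; zero; suc; _≤_; _<_; _+_; _*_; _∸_; z≤n; s≤s; s≤s⁻¹; s<s; z<s; NonZero; >-nonZero; >-nonZero⁻¹)
open import Data.Nat.Properties using (suc-injective; +-0-commutativeMonoid)
import Data.Nat.Properties as ℕ
open import Data.Nat.DivMod using (_/_; _%_; m/n*n≤m; m≡m%n+[m/n]*n; m%n<n)
open import Data.Nat.Solver using (module +-*-Solver)
open import Algebra.Properties.CommutativeMonoid.Sum +-0-commutativeMonoid using (sum; sum-cong-≗; ∑-distrib-+; ∑-comm; sum-remove; sum-replicate-zero; sum-init-last)
open import Data.Integer as ℤ using (-[1+_]) renaming (+_ to posℤ)
import Data.Integer.Properties as ℤ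
open import Data.Rational as ℚ using (ℚ; 0ℚ; mkℚ; toℚᵘ)
import Data.Rational.Properties as ℚ
open import Data.Rational.Unnormalised as ℚᵘ using (mkℚᵘ; _≃_; *≡*)
import Data.Rational.Unnormalised.Properties as ℚᵘ
open import Data.Fin using (Fin; zero; suc; toℕ; fromℕ; fromℕ<; inject₁; punchIn; punchOut; combine; remQuot; splitAt; _↑ˡ_; _↑ʳ_)
open import Data.Fin.Properties using (toℕ<n; toℕ-fromℕ; toℕ-fromℕ<; toℕ-inject₁; toℕ-injective; any?; pigeonhole; punchInᵢ≢i; punchIn-punchOut; remQuot-combine; splitAt-↑ˡ; splitAt-↑ʳ)
import Data.Fin.Properties as Fin
open import Data.Bool using (Bool; true; false; _∧_; not; _xor_; if_then_else_)
open import Data.Bool.Properties using (xor-assoc; xor-comm; xor-same; xor-identityʳ; ¬-not)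
import Data.Bool.Properties as Bool
open import Data.Vec using (Vec; []; _∷_; lookup; _[_]≔_; replicate)
open import Data.Vec.Properties using ([]≔-lookup; []≔-idempotent; []≔-commutes; lookup∘update; lookup∘update′; lookup-replicate)
open import Data.Product using (Σ; ∃; ∃₂; _×_; _,_; proj₁; proj₂)
import Data.Product as Product
open import Data.Sum using (_⊎_; inj₁; inj₂)
import Data.Sum as Sum
open import Data.Sum.Properties using (inj₁-injective; ≡-dec)
open import Data.Empty using (⊥; ⊥-elim)
open import Function using (_∘_; Injective)
open import Relation.Nullary using (¬_; Dec; yes; no; does; ¬?)
open import Relation.Nullary.Decidable using (_×-dec_; _⊎-dec_)
open import Relation.Binary using (DecidableEquality)
open import Relation.Binary.PropositionalEquality

-- Exploding a conflict between `e` and `f` deletes three lines: the row and the column of `e`, and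
-- one further line of `f`. In general they weigh up to α + 2β if `f` is in the row of `e`, and 2α +
-- β if it is in the column. Two savings reduce this to α + β. If (b , c) is the only entry of its
-- column, that column costs nothing once row b is gone; if it is the only entry of its row,
-- removing column c empties row b and the whole loss is at most 2β, where β ≤ α because n ≤ m. And
-- since row conflicts are relaxed before column conflicts, the row of `e` is not lost in the column
-- phase. Edges and weight are kept apart: the weight is a table on pairs of vertices that need only
-- be covered by edges, so it can be exchanged for one with the same margins and no larger support
-- while the complex stays fixed. The requirement (|K| - d - 1)(α + β) < |K| α is hardest for |K| =
-- n, where α : β = m : n turns it into n² < (d + 1)(m + n).

private variable
  n N M k p q : ℕ

-- Chains modulo 2

-- Chains over 𝔽₂ on the subsets of Fin n: node c d carries c on the subsets avoiding vertex 0 and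
-- d on those containing it.
data Chain : ℕ → Set where
  pt   : Bool → Chain 0
  node : Chain n → Chain n → Chain (suc n)

infixl 6 _⊕_
_⊕_ : Chain n → Chain n → Chain n
pt a ⊕ pt b = pt (a xor b)
node c d ⊕ node c′ d′ = node (c ⊕ c′) (d ⊕ d′)

𝟘 : Chain n
𝟘 {zero}  = pt false
𝟘 {suc n} = node 𝟘 𝟘

-- The augmented boundary: a vertex has the empty face as its boundary, so filling the chain `unit`
-- amounts to having a vertex.
∂ : Chain n → Chain n
∂ (pt _)     = pt false
∂ (node c d) = node (∂ c ⊕ d) (∂ d)

-- μ u adjoins the vertex u (killing the faces that contain it), ι u removes it (killing the others).
μ : Fin n → Chain n → Chain n
μ zero    (node c d) = node 𝟘 c
μ (suc u) (node c d) = node (μ u c) (μ u d)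

ι : Fin n → Chain n → Chain n
ι zero    (node c d) = node d 𝟘
ι (suc u) (node c d) = node (ι u c) (ι u d)

⊕-assoc : (c d e : Chain n) → (c ⊕ d) ⊕ e ≡ c ⊕ (d ⊕ e)
⊕-assoc (pt a) (pt b) (pt c) = cong pt (xor-assoc a b c)
⊕-assoc (node a a′) (node b b′) (node c c′) = cong₂ node (⊕-assoc a b c) (⊕-assoc a′ b′ c′)

⊕-comm : (c d : Chain n) → c ⊕ d ≡ d ⊕ c
⊕-comm (pt a) (pt b) = cong pt (xor-comm a b)
⊕-comm (node a a′) (node b b′) = cong₂ node (⊕-comm a b) (⊕-comm a′ b′)

⊕-self : (c : Chain n) → c ⊕ c ≡ 𝟘
⊕-self (pt a) = cong pt (xor-same a)
⊕-self (node a a′) = cong₂ node (⊕-self a) (⊕-self a′)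

⊕-identityˡ : (c : Chain n) → 𝟘 ⊕ c ≡ c
⊕-identityˡ (pt a) = refl
⊕-identityˡ (node a a′) = cong₂ node (⊕-identityˡ a) (⊕-identityˡ a′)

⊕-identityʳ : (c : Chain n) → c ⊕ 𝟘 ≡ c
⊕-identityʳ c = trans (⊕-comm c 𝟘) (⊕-identityˡ c)

⊕-cancelʳ : (c d : Chain n) → (c ⊕ d) ⊕ d ≡ c
⊕-cancelʳ c d = trans (⊕-assoc c d d) (trans (cong (c ⊕_) (⊕-self d)) (⊕-identityʳ c))

⊕-cancelˡ : (c d : Chain n) → c ⊕ (c ⊕ d) ≡ d
⊕-cancelˡ c d = trans (sym (⊕-assoc c c d)) (trans (cong (_⊕ d) (⊕-self c)) (⊕-identityˡ d))

⊕-interchange : (a b c d : Chain n) → (a ⊕ b) ⊕ (c ⊕ d) ≡ (a ⊕ c) ⊕ (b ⊕ d)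
⊕-interchange a b c d = begin
  (a ⊕ b) ⊕ (c ⊕ d) ≡⟨ ⊕-assoc a b (c ⊕ d) ⟩
  a ⊕ (b ⊕ (c ⊕ d)) ≡⟨ cong (a ⊕_) (⊕-assoc b c d) ⟨
  a ⊕ ((b ⊕ c) ⊕ d) ≡⟨ cong (λ t → a ⊕ (t ⊕ d)) (⊕-comm b c) ⟩
  a ⊕ ((c ⊕ b) ⊕ d) ≡⟨ cong (a ⊕_) (⊕-assoc c b d) ⟩
  a ⊕ (c ⊕ (b ⊕ d)) ≡⟨ ⊕-assoc a c (b ⊕ d) ⟨
  (a ⊕ c) ⊕ (b ⊕ d) ∎
  where open ≡-Reasoning

∂-𝟘 : ∂ (𝟘 {n}) ≡ 𝟘
∂-𝟘 {zero}  = refl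
∂-𝟘 {suc n} rewrite ∂-𝟘 {n} = cong (λ c → node c 𝟘) (⊕-self 𝟘)

μ-𝟘 : (u : Fin n) → μ u 𝟘 ≡ 𝟘
μ-𝟘 zero    = refl
μ-𝟘 (suc u) = cong₂ node (μ-𝟘 u) (μ-𝟘 u)

∂-⊕ : (c d : Chain n) → ∂ (c ⊕ d) ≡ ∂ c ⊕ ∂ d
∂-⊕ (pt _) (pt _) = refl
∂-⊕ (node a a′) (node b b′) = cong₂ node
  (trans (cong (_⊕ (a′ ⊕ b′)) (∂-⊕ a b)) (⊕-interchange (∂ a) (∂ b) a′ b′)) (∂-⊕ a′ b′)

μ-⊕ : (u : Fin n) (c d : Chain n) → μ u (c ⊕ d) ≡ μ u c ⊕ μ u d
μ-⊕ zero    (node a a′) (node b b′) = cong (λ c → node c (a ⊕ b)) (sym (⊕-self 𝟘))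
μ-⊕ (suc u) (node a a′) (node b b′) = cong₂ node (μ-⊕ u a b) (μ-⊕ u a′ b′)

-- The cone formula. It also covers faces that contain `u`: these are killed by `μ u`, and among
-- their facets only the one without `u` survives `μ u`, giving the face back.
∂-μ : (u : Fin n) (c : Chain n) → ∂ (μ u c) ≡ c ⊕ μ u (∂ c)
∂-μ zero (node c d) = cong₂ node
  (trans (cong (_⊕ c) ∂-𝟘) (trans (⊕-identityˡ c) (sym (⊕-identityʳ c))))
  (trans (sym (⊕-cancelˡ d (∂ c))) (cong (d ⊕_) (⊕-comm d (∂ c))))
∂-μ (suc u) (node c d) = cong₂ node
  (begin
    ∂ (μ u c) ⊕ μ u d             ≡⟨ cong (_⊕ μ u d) (∂-μ u c) ⟩
    (c ⊕ μ u (∂ c)) ⊕ μ u d       ≡⟨ ⊕-assoc c (μ u (∂ c)) (μ u d) ⟩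
    c ⊕ (μ u (∂ c) ⊕ μ u d)       ≡⟨ cong (c ⊕_) (μ-⊕ u (∂ c) d) ⟨
    c ⊕ μ u (∂ c ⊕ d)             ∎)
  (∂-μ u d)
  where open ≡-Reasoning

ι-⊕ : (u : Fin n) (c d : Chain n) → ι u (c ⊕ d) ≡ ι u c ⊕ ι u d
ι-⊕ zero    (node a a′) (node b b′) = cong (node (a′ ⊕ b′)) (sym (⊕-self 𝟘))
ι-⊕ (suc u) (node a a′) (node b b′) = cong₂ node (ι-⊕ u a b) (ι-⊕ u a′ b′)

-- Passing to the link of `u` is a chain map: the facet that drops `u` is killed by `ι u`, and the
-- others are the facets of the link face.
∂-ι : (u : Fin n) (c : Chain n) → ∂ (ι u c) ≡ ι u (∂ c)
∂-ι zero (node c d) = cong₂ node (⊕-identityʳ (∂ d)) ∂-𝟘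
∂-ι (suc u) (node c d) = cong₂ node
  (trans (cong (_⊕ ι u d) (∂-ι u c)) (sym (ι-⊕ u (∂ c) d))) (∂-ι u d)

-- Faces, coefficients and supports of chains

Face : ℕ → Set
Face = Vec Bool

infix 4 _∈_ _∉_
_∈_ _∉_ : Fin n → Face n → Set
u ∈ F = lookup F u ≡ true
u ∉ F = lookup F u ≡ false

∈⇒¬∉ : {u : Fin n} {F : Face n} → u ∈ F → ¬ (u ∉ F)
∈⇒¬∉ p q with trans (sym p) q
... | ()

coef : Chain n → Face n → Bool
coef (pt b)     []          = b
coef (node c d) (false ∷ F) = coef c F
coef (node c d) (true  ∷ F) = coef d F

coef-𝟘 : (F : Face n) → coef 𝟘 F ≡ false
coef-𝟘 []          = refl
coef-𝟘 (false ∷ F) = coef-𝟘 F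
coef-𝟘 (true  ∷ F) = coef-𝟘 F

coef-⊕ : (c d : Chain n) (F : Face n) → coef (c ⊕ d) F ≡ coef c F xor coef d F
coef-⊕ (pt a) (pt b) [] = refl
coef-⊕ (node c d) (node c′ d′) (false ∷ F) = coef-⊕ c c′ F
coef-⊕ (node c d) (node c′ d′) (true  ∷ F) = coef-⊕ d d′ F

coef-μ : (u : Fin n) (c : Chain n) (F : Face n) →
         coef (μ u c) F ≡ lookup F u ∧ coef c (F [ u ]≔ false)
coef-μ zero    (node c d) (false ∷ F) = coef-𝟘 F
coef-μ zero    (node c d) (true  ∷ F) = refl
coef-μ (suc u) (node c d) (false ∷ F) = coef-μ u c F
coef-μ (suc u) (node c d) (true  ∷ F) = coef-μ u d F

coef-ι : (u : Fin n) (c : Chain n) (F : Face n) →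
         coef (ι u c) F ≡ not (lookup F u) ∧ coef c (F [ u ]≔ true)
coef-ι zero    (node c d) (false ∷ F) = refl
coef-ι zero    (node c d) (true  ∷ F) = coef-𝟘 F
coef-ι (suc u) (node c d) (false ∷ F) = coef-ι u c F
coef-ι (suc u) (node c d) (true  ∷ F) = coef-ι u d F

coef-ext : (c d : Chain n) → (∀ F → coef c F ≡ coef d F) → c ≡ d
coef-ext (pt a) (pt b) h = cong pt (h [])
coef-ext (node c d) (node c′ d′) h =
  cong₂ node (coef-ext c c′ λ F → h (false ∷ F)) (coef-ext d d′ λ F → h (true ∷ F))

size : Face n → ℕ
size []          = 0
size (false ∷ F) = size F
size (true  ∷ F) = suc (size F)

size-insert : (F : Face n) (u : Fin n) → u ∉ F → size (F [ u ]≔ true) ≡ suc (size F)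
size-insert (false ∷ F) zero    p = refl
size-insert (false ∷ F) (suc u) p = size-insert F u p
size-insert (true  ∷ F) (suc u) p = cong suc (size-insert F u p)

size-delete : (F : Face n) (u : Fin n) → u ∈ F → size F ≡ suc (size (F [ u ]≔ false))
size-delete (true  ∷ F) zero    p = refl
size-delete (false ∷ F) (suc u) p = size-delete F u p
size-delete (true  ∷ F) (suc u) p = cong suc (size-delete F u p)

insert-delete : (F : Face n) (u : Fin n) → u ∈ F → (F [ u ]≔ false) [ u ]≔ true ≡ F
insert-delete F u p = trans ([]≔-idempotent F u) (trans (cong (F [ u ]≔_) (sym p)) ([]≔-lookup F u))

Complex : ℕ → Set₁
Complex n = Face n → Set

infix 4 _⊑_
_⊑_ : Chain n → Complex n → Set
c ⊑ X = ∀ F → coef c F ≡ true → X F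

_ofSize_ : Complex n → ℕ → Complex n
(X ofSize s) F = X F × size F ≡ s

∧-true : ∀ {a b} → a ∧ b ≡ true → a ≡ true × b ≡ true
∧-true {true} {true} refl = refl , refl

xor-true : ∀ {a b} → a xor b ≡ true → a ≡ true ⊎ b ≡ true
xor-true {true}  _ = inj₁ refl
xor-true {false} p = inj₂ p

not-true : ∀ {a} → not a ≡ true → a ≡ false
not-true {false} _ = refl

⊑-⊕ : {c d : Chain n} {X : Complex n} → c ⊑ X → d ⊑ X → c ⊕ d ⊑ X
⊑-⊕ {c = c} {d} p q F e with xor-true (trans (sym (coef-⊕ c d F)) e)
... | inj₁ a = p F a
... | inj₂ b = q F b

coef-μ-true : (u : Fin n) (c : Chain n) (F : Face n) → coef (μ u c) F ≡ true →
              u ∈ F × coef c (F [ u ]≔ false) ≡ true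
coef-μ-true u c F e = ∧-true (trans (sym (coef-μ u c F)) e)

coef-ι-true : (u : Fin n) (c : Chain n) (F : Face n) → coef (ι u c) F ≡ true →
              u ∉ F × coef c (F [ u ]≔ true) ≡ true
coef-ι-true u c F e with ∧-true (trans (sym (coef-ι u c F)) e)
... | p , q = not-true p , q

⊑-∅⇒𝟘 : (c : Chain n) → (c ⊑ λ _ → ⊥) → c ≡ 𝟘
⊑-∅⇒𝟘 c h = coef-ext c 𝟘 λ F → trans (lemma (coef c F) (h F)) (sym (coef-𝟘 F))
  where
  lemma : ∀ b → (b ≡ true → ⊥) → b ≡ false
  lemma true  p = ⊥-elim (p refl)
  lemma false _ = refl

⊑-μ : (u : Fin n) {c : Chain n} {Y X : Complex n} {s : ℕ} → c ⊑ (Y ofSize s) →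
      (∀ F → u ∉ F → Y F → X (F [ u ]≔ true)) → μ u c ⊑ (X ofSize suc s)
⊑-μ u {c} {X = X} h g F e with coef-μ-true u c F e
... | p , q with h _ q
... | y , sz = subst X (insert-delete F u p) (g _ (lookup∘update u F false) y) ,
               trans (size-delete F u p) (cong suc sz)

-- "X has no homology below dimension k - 1": a chain on faces of size s has dimension s - 1.
Fill : Complex n → ℕ → Set
Fill {n} X k = ∀ s → s < k → (z : Chain n) → ∂ z ≡ 𝟘 → z ⊑ (X ofSize s) →
  Σ (Chain n) λ c → ∂ c ≡ z × c ⊑ (X ofSize suc s)

Fill-cong : {X Y : Complex n} → (∀ F → X F → Y F) → (∀ F → Y F → X F) → Fill X k → Fill Y k
Fill-cong to from fill s s<k z ∂z z⊑ with fill s s<k z ∂z (λ F e → from F (proj₁ (z⊑ F e)) , proj₂ (z⊑ F e))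
... | c , ∂c , c⊑ = c , ∂c , λ F e → to F (proj₁ (c⊑ F e)) , proj₂ (c⊑ F e)

-- A cycle is filled by its cone with apex `u`, because the term `μ u (∂ z)` of the cone formula
-- vanishes.
Fill-cone : {X : Complex n} (u : Fin n) → (∀ F → X F → X (F [ u ]≔ true)) → ∀ k → Fill X k
Fill-cone u h k s s<k z ∂z z⊑ =
  μ u z , trans (∂-μ u z) (trans (cong (λ t → z ⊕ μ u t) ∂z) (trans (cong (z ⊕_) (μ-𝟘 u)) (⊕-identityʳ z))) ,
  ⊑-μ u z⊑ (λ F _ → h F)

-- Meshulam: for independence complexes, Y is X with the edge uv deleted from the graph, and Z is
-- X with uv exploded.
Fill-exchange : {X Y Z : Complex n} (u v : Fin n) → u ≢ v →
  (∀ F → X F → Y F) →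
  (∀ F → Y F → ¬ (u ∈ F × v ∈ F) → X F) →
  (∀ F → X F → ¬ (u ∈ F × v ∈ F)) →
  (∀ F → u ∉ F → v ∉ F → Y ((F [ u ]≔ true) [ v ]≔ true) → Z F) →
  (∀ F → Z F → X (F [ u ]≔ true) × X (F [ v ]≔ true)) →
  Fill Y (suc k) → Fill Z k → Fill X (suc k)
Fill-exchange {n} {k} {X} {Y} {Z} u v u≢v X⊆Y Y⊆X X∌uv Y→Z Z→X fillY fillZ s s<k z ∂z z⊑
  with fillY s s<k z ∂z (λ F e → X⊆Y F (proj₁ (z⊑ F e)) , proj₂ (z⊑ F e))
... | c , ∂c , c⊑ = c₀ ⊕ (μ u y ⊕ μ v y) , eq , ⊑-⊕ {c = c₀} c₀⊑ (⊑-⊕ {c = μ u y} {d = μ v y}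
        (⊑-μ u {c = y} y⊑ (λ F _ zf → proj₁ (Z→X F zf)))
        (⊑-μ v {c = y} y⊑ (λ F _ zf → proj₂ (Z→X F zf))))
  where
  open ≡-Reasoning
  -- The filling `c` in Y is wrong only on its faces containing both `u` and `v`; `w` is what they
  -- leave without these two vertices. As `z` has no such face, `w` is a cycle. It bounds some `y`
  -- in Z, and the suspension `μ u y ⊕ μ v y` has the same boundary as the discarded part
  -- `μ u (μ v w)`.
  w = ι u (ι v c)

  w-true : ∀ F → coef w F ≡ true → u ∉ F × v ∉ F × coef c ((F [ u ]≔ true) [ v ]≔ true) ≡ true
  w-true F e with coef-ι-true u (ι v c) F e
  ... | p , q with coef-ι-true v c (F [ u ]≔ true) q
  ... | p′ , q′ = p , trans (sym (lookup∘update′ (≢-sym u≢v) F true)) p′ , q′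

  w-size : ∀ F → coef w F ≡ true → Z F × suc (size F) ≡ s
  w-size F e with w-true F e
  ... | p , p′ , q = Y→Z F p p′ (proj₁ (c⊑ _ q)) , suc-injective (trans (sym (trans
        (size-insert (F [ u ]≔ true) v (trans (lookup∘update′ (≢-sym u≢v) F true) p′))
        (cong suc (size-insert F u p)))) (proj₂ (c⊑ _ q)))

  z-uv : ι u (ι v z) ≡ 𝟘
  z-uv = ⊑-∅⇒𝟘 _ λ F e → let p , q = coef-ι-true u (ι v z) F e
                             p′ , q′ = coef-ι-true v z (F [ u ]≔ true) q
                         in X∌uv _ (proj₁ (z⊑ _ q′))
                              (trans (lookup∘update′ u≢v (F [ u ]≔ true) true) (lookup∘update u F true) ,
                               lookup∘update v (F [ u ]≔ true) true)

  ∂w : ∂ w ≡ 𝟘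
  ∂w = trans (∂-ι u (ι v c)) (trans (cong (ι u) (trans (∂-ι v c) (cong (ι v) ∂c))) z-uv)

  fillw : ∀ s′ → s′ ≡ s → Σ (Chain n) λ y → ∂ y ≡ w × y ⊑ (Z ofSize s)
  -- The faces of `w` have size s - 1, so there are none when s = 0. For larger s this shift is why
  -- filling Z one dimension lower is enough.
  fillw zero refl = 𝟘 , trans ∂-𝟘 (sym (⊑-∅⇒𝟘 w λ F e → 0≢suc (proj₂ (w-size F e)))) ,
                    λ F e → ⊥-elim (∈≢ (trans (sym e) (coef-𝟘 F)))
    where
    0≢suc : ∀ {m} → suc m ≡ 0 → ⊥
    0≢suc ()
    ∈≢ : true ≡ false → ⊥
    ∈≢ ()
  fillw (suc s′) refl = fillZ s′ (lower s<k) w ∂w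
      (λ F e → proj₁ (w-size F e) , suc-injective (proj₂ (w-size F e)))
    where
    lower : ∀ {a b} → suc a < suc b → a < b
    lower (s≤s p) = p

  y   = proj₁ (fillw s refl)
  ∂y  = proj₁ (proj₂ (fillw s refl))
  y⊑  = proj₂ (proj₂ (fillw s refl))
  -- On faces containing both `u` and `v` the two summands agree, so they cancel modulo 2 and `c₀`
  -- lies in X.
  c₀  = c ⊕ μ u (μ v w)

  coef-uv : ∀ F → u ∈ F → v ∈ F → coef (μ u (μ v w)) F ≡ coef c F
  coef-uv F p q = begin
    coef (μ u (μ v w)) F
      ≡⟨ coef-μ u (μ v w) F ⟩
    lookup F u ∧ coef (μ v w) F₁
      ≡⟨ cong (_∧ coef (μ v w) F₁) p ⟩
    coef (μ v w) F₁
      ≡⟨ coef-μ v w F₁ ⟩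
    lookup F₁ v ∧ coef w F₂
      ≡⟨ cong (_∧ coef w F₂) (trans (lookup∘update′ (≢-sym u≢v) F false) q) ⟩
    coef w F₂
      ≡⟨ coef-ι u (ι v c) F₂ ⟩
    not (lookup F₂ u) ∧ coef (ι v c) F₃
      ≡⟨ cong (λ t → not t ∧ coef (ι v c) F₃) (trans (lookup∘update′ u≢v F₁ false) (lookup∘update u F false)) ⟩
    coef (ι v c) F₃
      ≡⟨ coef-ι v c F₃ ⟩
    not (lookup F₃ v) ∧ coef c (F₃ [ v ]≔ true)
      ≡⟨ cong (λ t → not t ∧ coef c (F₃ [ v ]≔ true)) (trans (lookup∘update′ (≢-sym u≢v) F₂ true) (lookup∘update v F₁ false)) ⟩
    coef c (F₃ [ v ]≔ true)
      ≡⟨ cong (coef c) back ⟩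
    coef c F ∎
    where
    F₁ = F [ u ]≔ false
    F₂ = F₁ [ v ]≔ false
    F₃ = F₂ [ u ]≔ true
    back : F₃ [ v ]≔ true ≡ F
    back = trans ([]≔-commutes F₂ u v u≢v)
             (trans (cong (_[ u ]≔ true) (insert-delete F₁ v (trans (lookup∘update′ (≢-sym u≢v) F false) q)))
                    (insert-delete F u p))

  c₀⊑ : c₀ ⊑ (X ofSize suc s)
  c₀⊑ F e = Y⊆X F (proj₁ yF) no-uv , proj₂ yF
    where
    no-uv : ¬ (u ∈ F × v ∈ F)
    no-uv (p , q) with trans (sym e) (trans (coef-⊕ c (μ u (μ v w)) F)
                         (trans (cong (coef c F xor_) (coef-uv F p q)) (xor-same (coef c F))))
    ... | ()
    yF : (Y ofSize suc s) F
    yF with xor-true (trans (sym (coef-⊕ c (μ u (μ v w)) F)) e)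
    ... | inj₁ a = c⊑ F a
    ... | inj₂ b with coef-μ-true u (μ v w) F b
    ... | p , b′ with coef-μ-true v w _ b′
    ... | q , _ = c⊑ F (trans (sym (coef-uv F p (trans (sym (lookup∘update′ (≢-sym u≢v) F false)) q))) b)

  ∂μw : ∀ t → ∂ (μ t y) ≡ y ⊕ μ t w
  ∂μw t = trans (∂-μ t y) (cong (λ q → y ⊕ μ t q) ∂y)

  ∂uvw : ∂ (μ u (μ v w)) ≡ μ v w ⊕ μ u w
  ∂uvw = trans (∂-μ u (μ v w)) (cong (λ t → μ v w ⊕ μ u t)
    (trans (∂-μ v w) (trans (cong (λ t → w ⊕ μ v t) ∂w) (trans (cong (w ⊕_) (μ-𝟘 v)) (⊕-identityʳ w)))))

  ∂y-part : ∂ (μ u y ⊕ μ v y) ≡ μ u w ⊕ μ v w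
  ∂y-part = begin
    ∂ (μ u y ⊕ μ v y)              ≡⟨ ∂-⊕ (μ u y) (μ v y) ⟩
    ∂ (μ u y) ⊕ ∂ (μ v y)          ≡⟨ cong₂ _⊕_ (∂μw u) (∂μw v) ⟩
    (y ⊕ μ u w) ⊕ (y ⊕ μ v w)      ≡⟨ ⊕-interchange y (μ u w) y (μ v w) ⟩
    (y ⊕ y) ⊕ (μ u w ⊕ μ v w)      ≡⟨ cong (_⊕ (μ u w ⊕ μ v w)) (⊕-self y) ⟩
    𝟘 ⊕ (μ u w ⊕ μ v w)            ≡⟨ ⊕-identityˡ _ ⟩
    μ u w ⊕ μ v w                  ∎

  eq : ∂ (c₀ ⊕ (μ u y ⊕ μ v y)) ≡ z
  eq = begin
    ∂ (c₀ ⊕ (μ u y ⊕ μ v y))                    ≡⟨ ∂-⊕ c₀ _ ⟩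
    ∂ c₀ ⊕ ∂ (μ u y ⊕ μ v y)                    ≡⟨ cong₂ _⊕_ (trans (∂-⊕ c (μ u (μ v w))) (cong₂ _⊕_ ∂c ∂uvw)) ∂y-part ⟩
    (z ⊕ (μ v w ⊕ μ u w)) ⊕ (μ u w ⊕ μ v w)     ≡⟨ cong (λ t → (z ⊕ t) ⊕ (μ u w ⊕ μ v w)) (⊕-comm (μ v w) (μ u w)) ⟩
    (z ⊕ (μ u w ⊕ μ v w)) ⊕ (μ u w ⊕ μ v w)     ≡⟨ ⊕-cancelʳ z _ ⟩
    z                                           ∎

-- Matching complexes

∈-insert⁻ : ∀ {n} {F : Face n} {u i : Fin n} → i ∈ F [ u ]≔ true → i ≡ u ⊎ i ∈ F
∈-insert⁻ {F = F} {u} {i} p with i Fin.≟ u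
... | yes i≡u = inj₁ i≡u
... | no  i≢u = inj₂ (trans (sym (lookup∘update′ i≢u F true)) p)

∈-insert : ∀ {n} {F : Face n} {u i : Fin n} → i ∈ F → i ∈ F [ u ]≔ true
∈-insert {F = F} {u} {i} p with i Fin.≟ u
... | yes refl = lookup∘update u F true
... | no  i≢u  = trans (lookup∘update′ i≢u F true) p

∈-self : ∀ {n} {F : Face n} {u : Fin n} → u ∈ F [ u ]≔ true
∈-self {F = F} {u} = lookup∘update u F true

module LineGraph {N : ℕ} {R S : Set} (_≟R_ : DecidableEquality R) (_≟S_ : DecidableEquality S)
                 (row : Fin N → R) (col : Fin N → S) where

  Meet : Fin N → Fin N → Set
  Meet i j = row i ≡ row j ⊎ col i ≡ col j

  Meet-sym : ∀ {i j} → Meet i j → Meet j i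
  Meet-sym (inj₁ p) = inj₁ (sym p)
  Meet-sym (inj₂ p) = inj₂ (sym p)

  Matching : (Fin N → Set) → Complex N
  Matching P F = (∀ i → i ∈ F → P i) × (∀ i j → i ∈ F → j ∈ F → i ≢ j → ¬ Meet i j)

  module _ (P : Fin N → Set) (e : Fin N) (Pe : P e) where

    -- Matchings in which e may also meet the edges in D.
    Relaxed : (Fin N → Set) → Complex N
    Relaxed D F = (∀ i → i ∈ F → P i) ×
      (∀ i j → i ∈ F → j ∈ F → i ≢ j → Meet i j → (i ≡ e × D j) ⊎ (j ≡ e × D i))

    Relaxed-mono : {D D′ : Fin N → Set} → (∀ i → P i → D i → D′ i) → ∀ F → Relaxed D F → Relaxed D′ F
    Relaxed-mono h F (p , q) = p , λ i j i∈ j∈ i≢j m →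
      Sum.map (Product.map₂ (h j (p j j∈))) (Product.map₂ (h i (p i i∈))) (q i j i∈ j∈ i≢j m)

    -- Used for both ends of an exchange: inserting `e` may create conflicts inside `D`, while
    -- inserting any other edge must create none.
    Relaxed-insert : {D : Fin N → Set} {P′ : Fin N → Set} (f : Fin N) → P f → (∀ i → P′ i → P i) →
      (∀ i → P′ i → Meet f i → (f ≡ e × D i)) → ∀ F → Matching P′ F → Relaxed D (F [ f ]≔ true)
    Relaxed-insert {D} f Pf P′⊆P ok F (p , q) = alive , indep
      where
      alive : ∀ i → i ∈ F [ f ]≔ true → P i
      alive i i∈ with ∈-insert⁻ {F = F} i∈
      ... | inj₁ refl = Pf
      ... | inj₂ i∈F  = P′⊆P i (p i i∈F)
      indep : ∀ i j → i ∈ F [ f ]≔ true → j ∈ F [ f ]≔ true → i ≢ j → Meet i j → (i ≡ e × D j) ⊎ (j ≡ e × D i)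
      indep i j i∈ j∈ i≢j m with ∈-insert⁻ {F = F} i∈ | ∈-insert⁻ {F = F} j∈
      ... | inj₁ refl | inj₁ refl = ⊥-elim (i≢j refl)
      ... | inj₁ refl | inj₂ j∈F  = inj₁ (ok j (p j j∈F) m)
      ... | inj₂ i∈F  | inj₁ refl = inj₂ (ok i (p i i∈F) (Meet-sym m))
      ... | inj₂ i∈F  | inj₂ j∈F  = ⊥-elim (q i j i∈F j∈F i≢j m)

    -- One exchange on the pair `e`, `f`. Passing from `D` to `D′` deletes their conflict; `P′` is
    -- what survives its explosion, namely the edges that do not meet `f` and meet `e` only as far
    -- as `D` already permits.
    Relaxed-step : ∀ {k} {D D′ P′ : Fin N → Set} (f : Fin N) → f ≢ e → Meet e f → P f → ¬ D f →
      (∀ i → D i → D′ i) → (∀ i → D′ i → D i ⊎ i ≡ f) →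
      (∀ i → P i → ¬ Meet f i → (Meet e i → D i) → P′ i) →
      (∀ i → P′ i → P i × ¬ Meet f i × (Meet e i → D i)) →
      Fill (Matching P′) k → Fill (Relaxed D′) (suc k) → Fill (Relaxed D) (suc k)
    Relaxed-step {k} {D} {D′} {P′} f f≢e e∼f Pf ¬Df D⊆D′ D′⊆D to from fillZ fillY =
      Fill-exchange {X = Relaxed D} {Relaxed D′} {Matching P′} e f (≢-sym f≢e)
        (Relaxed-mono λ i _ → D⊆D′ i)
        (λ F r no-ef → proj₁ r , λ i j i∈ j∈ i≢j m → shrink F no-ef i∈ j∈ (proj₂ r i j i∈ j∈ i≢j m))
        (λ F r (e∈ , f∈) → no-both (proj₂ r e f e∈ f∈ (≢-sym f≢e) e∼f))
        Y→Z
        (λ F z → Relaxed-insert e Pe (λ i p → proj₁ (from i p)) (λ i p m → refl , proj₂ (proj₂ (from i p)) m) F z ,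
                 Relaxed-insert f Pf (λ i p → proj₁ (from i p)) (λ i p m → ⊥-elim (proj₁ (proj₂ (from i p)) m)) F z)
        fillY fillZ
      where
      shrink : ∀ F → ¬ (e ∈ F × f ∈ F) → ∀ {i j} → i ∈ F → j ∈ F →
               (i ≡ e × D′ j) ⊎ (j ≡ e × D′ i) → (i ≡ e × D j) ⊎ (j ≡ e × D i)
      shrink F no-ef i∈ j∈ (inj₁ (refl , d)) with D′⊆D _ d
      ... | inj₁ d′   = inj₁ (refl , d′)
      ... | inj₂ refl = ⊥-elim (no-ef (i∈ , j∈))
      shrink F no-ef i∈ j∈ (inj₂ (refl , d)) with D′⊆D _ d
      ... | inj₁ d′   = inj₂ (refl , d′)
      ... | inj₂ refl = ⊥-elim (no-ef (j∈ , i∈))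
      no-both : (e ≡ e × D f) ⊎ (f ≡ e × D e) → ⊥
      no-both (inj₁ (_ , d)) = ¬Df d
      no-both (inj₂ (p , _)) = f≢e p
      Y→Z : ∀ F → e ∉ F → f ∉ F → Relaxed D′ ((F [ e ]≔ true) [ f ]≔ true) → Matching P′ F
      Y→Z F e∉ f∉ (p , q) = alive , indep
        where
        F⁺ = (F [ e ]≔ true) [ f ]≔ true
        up : ∀ {i} → i ∈ F → i ∈ F⁺
        up i∈ = ∈-insert {F = F [ e ]≔ true} (∈-insert {F = F} i∈)
        e∈⁺ : e ∈ F⁺
        e∈⁺ = ∈-insert {F = F [ e ]≔ true} (∈-self {F = F})
        f∈⁺ : f ∈ F⁺
        f∈⁺ = ∈-self {F = F [ e ]≔ true}
        ≢e : ∀ {i} → i ∈ F → i ≢ e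
        ≢e i∈ refl = ∈⇒¬∉ {F = F} i∈ e∉
        ≢f : ∀ {i} → i ∈ F → i ≢ f
        ≢f i∈ refl = ∈⇒¬∉ {F = F} i∈ f∉
        alive : ∀ i → i ∈ F → P′ i
        alive i i∈ = to i (p i (up i∈)) not-f via-e
          where
          not-f : ¬ Meet f i
          not-f m with q f i f∈⁺ (up i∈) (≢-sym (≢f i∈)) m
          ... | inj₁ (r , _) = f≢e r
          ... | inj₂ (r , _) = ≢e i∈ r
          via-e : Meet e i → D i
          via-e m with q e i e∈⁺ (up i∈) (≢-sym (≢e i∈)) m
          ... | inj₂ (r , _) = ⊥-elim (≢e i∈ r)
          ... | inj₁ (_ , d) with D′⊆D i d
          ... | inj₁ d′ = d′
          ... | inj₂ r  = ⊥-elim (≢f i∈ r)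
        indep : ∀ i j → i ∈ F → j ∈ F → i ≢ j → ¬ Meet i j
        indep i j i∈ j∈ i≢j m with q i j (up i∈) (up j∈) i≢j m
        ... | inj₁ (r , _) = ≢e i∈ r
        ... | inj₂ (r , _) = ≢e j∈ r

    -- Meshulam's argument, relaxing first the conflicts of e in its row and then those in its
    -- column.  In the second phase the row of e survives, since e no longer conflicts with it.
    Matching-fill : ∀ {k} →
      (∀ f → P f → f ≢ e → row f ≡ row e →
         Fill (Matching λ i → P i × row i ≢ row e × col i ≢ col e × col i ≢ col f) k) →
      (∀ f → P f → col f ≡ col e → row f ≢ row e →
         Fill (Matching λ i → P i × col i ≢ col e × row i ≢ row f) k) →
      (P? : ∀ i → Dec (P i)) →
      Fill (Matching P) (suc k)
    Matching-fill {k} byRow byCol P? =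
      Fill-cong {X = Relaxed (D₁ 0)} {Y = Matching P}
        (λ F (p , q) → p , λ i j i∈ j∈ i≢j m → ¬D₁0 (q i j i∈ j∈ i≢j m))
        (λ F (p , q) → p , λ i j i∈ j∈ i≢j m → ⊥-elim (q i j i∈ j∈ i≢j m))
        (down₁ N ℕ.≤-refl
          (Fill-cong {X = Relaxed (D₂ 0)} {Y = Relaxed (D₁ N)}
            (Relaxed-mono λ i _ d → D₂0⊆ d) (Relaxed-mono λ i _ (x , y , _) → x , inj₁ y)
            -- Once every conflict of `e` is permitted, `e` can be added to any face and the complex
            -- is a cone.
            (down₂ N ℕ.≤-refl (Fill-cone e cone (suc k)))))
      where
      -- The conflicts are permitted in the order of their indices, `t` of which have been
      -- processed. `D₂ 0` coincides with `D₁ N`, which joins the two phases.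
      D₁ D₂ : ℕ → Fin N → Set
      D₁ t i = i ≢ e × row i ≡ row e × toℕ i < t
      D₂ t i = i ≢ e × (row i ≡ row e ⊎ (col i ≡ col e × toℕ i < t))

      ¬D₁0 : ∀ {i j} → (i ≡ e × D₁ 0 j) ⊎ (j ≡ e × D₁ 0 i) → ⊥
      ¬D₁0 (inj₁ (_ , _ , _ , ()))
      ¬D₁0 (inj₂ (_ , _ , _ , ()))

      D₂0⊆ : ∀ {i} → D₂ 0 i → D₁ N i
      D₂0⊆ {i} (x , inj₁ y) = x , y , toℕ<n i

      cone : ∀ F → Relaxed (D₂ N) F → Relaxed (D₂ N) (F [ e ]≔ true)
      cone F (p , q) = alive , indep
        where
        D-all : ∀ {i} → i ≢ e → Meet e i → D₂ N i
        D-all i≢e (inj₁ r) = i≢e , inj₁ (sym r)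
        D-all {i} i≢e (inj₂ r) = i≢e , inj₂ (sym r , toℕ<n i)
        alive : ∀ i → i ∈ F [ e ]≔ true → P i
        alive i i∈ with ∈-insert⁻ {F = F} i∈
        ... | inj₁ refl = Pe
        ... | inj₂ i∈F  = p i i∈F
        indep : ∀ i j → i ∈ F [ e ]≔ true → j ∈ F [ e ]≔ true → i ≢ j → Meet i j →
                (i ≡ e × D₂ N j) ⊎ (j ≡ e × D₂ N i)
        indep i j i∈ j∈ i≢j m with ∈-insert⁻ {F = F} i∈ | ∈-insert⁻ {F = F} j∈
        ... | inj₁ refl | _         = inj₁ (refl , D-all (≢-sym i≢j) m)
        ... | inj₂ _    | inj₁ refl = inj₂ (refl , D-all i≢j (Meet-sym m))
        ... | inj₂ i∈F  | inj₂ j∈F  = q i j i∈F j∈F i≢j m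

      Relaxed-irrelevant : ∀ {D D′ : Fin N → Set} → (∀ i → D i → D′ i) →
        (∀ i → D′ i → P i → D i) → Fill (Relaxed D′) (suc k) → Fill (Relaxed D) (suc k)
      Relaxed-irrelevant {D} {D′} up dn = Fill-cong {X = Relaxed D′} {Relaxed D}
        (Relaxed-mono λ i p d → dn i d p) (Relaxed-mono λ i _ → up i)

      last? : ∀ {t} (i : Fin N) → toℕ i < suc t → toℕ i < t ⊎ toℕ i ≡ t
      last? i = ℕ.m<1+n⇒m<n∨m≡n

      step₁ : ∀ f → Fill (Relaxed (D₁ (suc (toℕ f)))) (suc k) → Fill (Relaxed (D₁ (toℕ f))) (suc k)
      step₁ f with f Fin.≟ e | row f ≟R row e | P? f
      ... | yes f≡e | _ | _ = Relaxed-irrelevant (λ i (x , y , z) → x , y , ℕ.m<n⇒m<1+n z) dn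
        where
        dn : ∀ i → D₁ (suc (toℕ f)) i → P i → D₁ (toℕ f) i
        dn i (x , y , z) _ with last? i z
        ... | inj₁ z′ = x , y , z′
        ... | inj₂ z′ = ⊥-elim (x (trans (toℕ-injective z′) f≡e))
      ... | no _ | no r | _ = Relaxed-irrelevant (λ i (x , y , z) → x , y , ℕ.m<n⇒m<1+n z) dn
        where
        dn : ∀ i → D₁ (suc (toℕ f)) i → P i → D₁ (toℕ f) i
        dn i (x , y , z) _ with last? i z
        ... | inj₁ z′ = x , y , z′
        ... | inj₂ z′ = ⊥-elim (r (subst (λ t → row t ≡ row e) (toℕ-injective z′) y))
      ... | no _ | yes _ | no ¬Pf = Relaxed-irrelevant (λ i (x , y , z) → x , y , ℕ.m<n⇒m<1+n z) dn
        where
        dn : ∀ i → D₁ (suc (toℕ f)) i → P i → D₁ (toℕ f) i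
        dn i (x , y , z) Pi with last? i z
        ... | inj₁ z′ = x , y , z′
        ... | inj₂ z′ = ⊥-elim (¬Pf (subst P (toℕ-injective z′) Pi))
      ... | no f≢e | yes r | yes Pf =
        Relaxed-step f f≢e (inj₁ (sym r)) Pf (λ (_ , _ , z) → ℕ.<-irrefl refl z)
          (λ i (x , y , z) → x , y , ℕ.m<n⇒m<1+n z) dn
          (λ i Pi ¬f via → Pi , (λ p → ¬f (inj₁ (trans r (sym p)))) ,
             (λ p → ¬f (inj₁ (trans r (sym (proj₁ (proj₂ (via (inj₂ (sym p)))))))) ) ,
             (λ p → ¬f (inj₂ (sym p))))
          (λ i (Pi , a , b , c) → Pi , (λ { (inj₁ p) → a (trans (sym p) r) ; (inj₂ p) → c (sym p) }) ,
             (λ { (inj₁ p) → ⊥-elim (a (sym p)) ; (inj₂ p) → ⊥-elim (b (sym p)) }))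
          (byRow f Pf f≢e r)
        where
        dn : ∀ i → D₁ (suc (toℕ f)) i → D₁ (toℕ f) i ⊎ i ≡ f
        dn i (x , y , z) with last? i z
        ... | inj₁ z′ = inj₁ (x , y , z′)
        ... | inj₂ z′ = inj₂ (toℕ-injective z′)

      mono₂ : ∀ t i → D₂ t i → D₂ (suc t) i
      mono₂ t i (x , inj₁ y)       = x , inj₁ y
      mono₂ t i (x , inj₂ (y , z)) = x , inj₂ (y , ℕ.m<n⇒m<1+n z)

      step₂ : ∀ f → Fill (Relaxed (D₂ (suc (toℕ f)))) (suc k) → Fill (Relaxed (D₂ (toℕ f))) (suc k)
      step₂ f with row f ≟R row e | col f ≟S col e | P? f
      ... | yes r | _ | _ = Relaxed-irrelevant (mono₂ (toℕ f)) dn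
        where
        dn : ∀ i → D₂ (suc (toℕ f)) i → P i → D₂ (toℕ f) i
        dn i (x , inj₁ y) _ = x , inj₁ y
        dn i (x , inj₂ (y , z)) _ with last? i z
        ... | inj₁ z′ = x , inj₂ (y , z′)
        ... | inj₂ z′ = x , inj₁ (trans (cong row (toℕ-injective z′)) r)
      ... | no _ | no c | _ = Relaxed-irrelevant (mono₂ (toℕ f)) dn
        where
        dn : ∀ i → D₂ (suc (toℕ f)) i → P i → D₂ (toℕ f) i
        dn i (x , inj₁ y) _ = x , inj₁ y
        dn i (x , inj₂ (y , z)) _ with last? i z
        ... | inj₁ z′ = x , inj₂ (y , z′)
        ... | inj₂ z′ = ⊥-elim (c (subst (λ t → col t ≡ col e) (toℕ-injective z′) y))
      ... | no _ | yes _ | no ¬Pf = Relaxed-irrelevant (mono₂ (toℕ f)) dn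
        where
        dn : ∀ i → D₂ (suc (toℕ f)) i → P i → D₂ (toℕ f) i
        dn i (x , inj₁ y) _ = x , inj₁ y
        dn i (x , inj₂ (y , z)) Pi with last? i z
        ... | inj₁ z′ = x , inj₂ (y , z′)
        ... | inj₂ z′ = ⊥-elim (¬Pf (subst P (toℕ-injective z′) Pi))
      ... | no ¬r | yes c | yes Pf =
        Relaxed-step f (λ p → ¬r (cong row p)) (inj₂ (sym c)) Pf ¬Df (mono₂ (toℕ f)) dn
          (λ i Pi ¬f via → Pi , (λ p → ¬f (inj₂ (trans c (sym p)))) , (λ p → ¬f (inj₁ (sym p))))
          (λ i (Pi , a , b) → Pi , (λ { (inj₁ p) → b (sym p) ; (inj₂ p) → a (trans (sym p) c) }) ,
             (λ { (inj₁ p) → (λ q → a (cong col q)) , inj₁ (sym p) ; (inj₂ p) → ⊥-elim (a (sym p)) }))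
          (byCol f Pf c ¬r)
        where
        ¬Df : ¬ D₂ (toℕ f) f
        ¬Df (_ , inj₁ y) = ¬r y
        ¬Df (_ , inj₂ (_ , z)) = ℕ.<-irrefl refl z
        dn : ∀ i → D₂ (suc (toℕ f)) i → D₂ (toℕ f) i ⊎ i ≡ f
        dn i (x , inj₁ y) = inj₁ (x , inj₁ y)
        dn i (x , inj₂ (y , z)) with last? i z
        ... | inj₁ z′ = inj₁ (x , inj₂ (y , z′))
        ... | inj₂ z′ = inj₂ (toℕ-injective z′)

      descend : (D : ℕ → Fin N → Set) →
        (∀ f → Fill (Relaxed (D (suc (toℕ f)))) (suc k) → Fill (Relaxed (D (toℕ f))) (suc k)) →
        ∀ t → t ≤ N → Fill (Relaxed (D t)) (suc k) → Fill (Relaxed (D 0)) (suc k)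
      descend D step zero    _   h = h
      descend D step (suc t) t<N h = descend D step t (ℕ.<⇒≤ t<N)
        (subst (λ s → Fill (Relaxed (D s)) (suc k)) (toℕ-fromℕ< t<N)
          (step (fromℕ< t<N) (subst (λ s → Fill (Relaxed (D (suc s))) (suc k)) (sym (toℕ-fromℕ< t<N)) h)))

      down₁ : ∀ t → t ≤ N → Fill (Relaxed (D₁ t)) (suc k) → Fill (Relaxed (D₁ 0)) (suc k)
      down₁ = descend D₁ step₁
      down₂ : ∀ t → t ≤ N → Fill (Relaxed (D₂ t)) (suc k) → Fill (Relaxed (D₂ 0)) (suc k)
      down₂ = descend D₂ step₂

-- Rainbow faces

⨁ : (Fin n → Chain N) → Chain N
⨁ {zero}  f = 𝟘
⨁ {suc n} f = f zero ⊕ ⨁ (f ∘ suc)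

⨁-cong : {f g : Fin n → Chain N} → (∀ i → f i ≡ g i) → ⨁ f ≡ ⨁ g
⨁-cong {zero}  h = refl
⨁-cong {suc n} h = cong₂ _⊕_ (h zero) (⨁-cong (h ∘ suc))

⨁-𝟘 : ∀ n → ⨁ {n} {N} (λ _ → 𝟘) ≡ 𝟘
⨁-𝟘 zero    = refl
⨁-𝟘 (suc n) = trans (cong (𝟘 ⊕_) (⨁-𝟘 n)) (⊕-self 𝟘)

⨁-⊕ : (f g : Fin n → Chain N) → ⨁ (λ i → f i ⊕ g i) ≡ ⨁ f ⊕ ⨁ g
⨁-⊕ {zero}  f g = sym (⊕-self 𝟘)
⨁-⊕ {suc n} f g = trans (cong ((f zero ⊕ g zero) ⊕_) (⨁-⊕ (f ∘ suc) (g ∘ suc)))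
                        (⊕-interchange (f zero) (g zero) _ _)

⨁-hom : (h : Chain N → Chain M) → h 𝟘 ≡ 𝟘 → (∀ c d → h (c ⊕ d) ≡ h c ⊕ h d) →
        (f : Fin n → Chain N) → h (⨁ f) ≡ ⨁ (h ∘ f)
⨁-hom {n = zero}  h h0 h⊕ f = h0
⨁-hom {n = suc n} h h0 h⊕ f = trans (h⊕ _ _) (cong (h (f zero) ⊕_) (⨁-hom h h0 h⊕ (f ∘ suc)))

-- Off the diagonal the terms cancel in pairs modulo 2. This is the form in which the boundary of a
-- sum over facets vanishes.
⨁-symmetric : (g : Fin n → Fin n → Chain N) → (∀ i j → g i j ≡ g j i) → (∀ i → g i i ≡ 𝟘) →
              ⨁ (λ i → ⨁ (g i)) ≡ 𝟘
⨁-symmetric {zero}  g s d = refl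
⨁-symmetric {suc n} g s d = begin
  (g zero zero ⊕ A) ⊕ ⨁ (λ i → g (suc i) zero ⊕ ⨁ (λ j → g (suc i) (suc j)))
    ≡⟨ cong₂ _⊕_ (trans (cong (_⊕ A) (d zero)) (⊕-identityˡ A))
         (⨁-⊕ (λ i → g (suc i) zero) (λ i → ⨁ (λ j → g (suc i) (suc j)))) ⟩
  A ⊕ (⨁ (λ i → g (suc i) zero) ⊕ ⨁ (λ i → ⨁ (λ j → g (suc i) (suc j))))
    ≡⟨ cong (A ⊕_) (cong₂ _⊕_ (⨁-cong λ i → s (suc i) zero)
         (⨁-symmetric (λ i j → g (suc i) (suc j)) (λ i j → s (suc i) (suc j)) (λ i → d (suc i)))) ⟩
  A ⊕ (A ⊕ 𝟘)
    ≡⟨ ⊕-cancelˡ A 𝟘 ⟩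
  𝟘 ∎
  where
  open ≡-Reasoning
  A = ⨁ (λ j → g zero (suc j))

⊑-⨁ : {f : Fin n → Chain N} {X : Complex N} → (∀ i → f i ⊑ X) → ⨁ f ⊑ X
⊑-⨁ {zero}  h F e with trans (sym e) (coef-𝟘 F)
... | ()
⊑-⨁ {suc n} {f = f} h = ⊑-⊕ {c = f zero} (h zero) (⊑-⨁ (h ∘ suc))

coef-⨁-𝟘 : (f : Fin n → Chain N) (F : Face N) → (∀ j → coef (f j) F ≡ false) → coef (⨁ f) F ≡ false
coef-⨁-𝟘 {zero}  f F h = coef-𝟘 F
coef-⨁-𝟘 {suc n} f F h = trans (coef-⊕ (f zero) _ F) (cong₂ _xor_ (h zero) (coef-⨁-𝟘 (f ∘ suc) F (h ∘ suc)))

coef-⨁-single : (f : Fin n → Chain N) (F : Face N) (i : Fin n) →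
  (∀ j → j ≢ i → coef (f j) F ≡ false) → coef (⨁ f) F ≡ coef (f i) F
coef-⨁-single {suc n} f F zero h = trans (coef-⊕ (f zero) _ F)
  (trans (cong (coef (f zero) F xor_) (coef-⨁-𝟘 (f ∘ suc) F (λ j → h (suc j) λ ()))) (xor-identityʳ _))
coef-⨁-single {suc n} f F (suc i) h = trans (coef-⊕ (f zero) _ F)
  (cong₂ _xor_ (h zero λ ()) (coef-⨁-single (f ∘ suc) F i (λ j j≢i → h (suc j) (j≢i ∘ Fin.suc-injective))))

coef-∂-𝟘 : (c : Chain n) (T : Face n) → (∀ j → j ∉ T → coef c (T [ j ]≔ true) ≡ false) →
           coef (∂ c) T ≡ false
coef-∂-𝟘 (pt _) [] h = refl
coef-∂-𝟘 (node c d) (true ∷ T) h = coef-∂-𝟘 d T (λ j → h (suc j))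
coef-∂-𝟘 (node c d) (false ∷ T) h = trans (coef-⊕ (∂ c) d T)
  (cong₂ _xor_ (coef-∂-𝟘 c T (λ j → h (suc j))) (h zero refl))

-- The coefficient of `T` in `∂ c` is the parity of the faces of `c` that add one vertex to `T`; if
-- only the one adding `i` can occur, that coefficient remains.
coef-∂-single : (c : Chain n) (T : Face n) (i : Fin n) → i ∉ T →
  (∀ j → j ≢ i → j ∉ T → coef c (T [ j ]≔ true) ≡ false) → coef (∂ c) T ≡ coef c (T [ i ]≔ true)
coef-∂-single (node c d) (false ∷ T) zero p h = trans (coef-⊕ (∂ c) d T)
  (cong (_xor coef d T) (coef-∂-𝟘 c T (λ j → h (suc j) λ ())))
coef-∂-single (node c d) (true ∷ T) (suc i) p h =
  coef-∂-single d T i p (λ j j≢i → h (suc j) (j≢i ∘ Fin.suc-injective))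
coef-∂-single (node c d) (false ∷ T) (suc i) p h = trans (coef-⊕ (∂ c) d T)
  (trans (cong₂ _xor_ (coef-∂-single c T i p (λ j j≢i → h (suc j) (j≢i ∘ Fin.suc-injective))) (h zero (λ ()) refl))
         (xor-identityʳ _))

unit : Chain n
unit {zero}  = pt true
unit {suc n} = node unit 𝟘

∂-unit : ∂ (unit {n}) ≡ 𝟘
∂-unit {zero}  = refl
∂-unit {suc n} = cong₂ node (trans (⊕-identityʳ _) ∂-unit) ∂-𝟘

unit-true : (F : Face n) → coef unit F ≡ true → F ≡ replicate n false
unit-true []          e = refl
unit-true (false ∷ F) e = cong (false ∷_) (unit-true F e)
unit-true (true  ∷ F) e with trans (sym e) (coef-𝟘 F)
... | ()

coef-unit : ∀ n → coef unit (replicate n false) ≡ true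
coef-unit zero    = refl
coef-unit (suc n) = coef-unit n

size-∅ : ∀ n → size (replicate n false) ≡ 0
size-∅ zero    = refl
size-∅ (suc n) = size-∅ n

size-zero : (F : Face n) → size F ≡ 0 → F ≡ replicate n false
size-zero []          e = refl
size-zero (false ∷ F) e = cong (false ∷_) (size-zero F e)

size-suc : (F : Face n) → size F ≡ suc k → ∃ λ i → i ∈ F
size-suc (true  ∷ F) e = zero , refl
size-suc (false ∷ F) e with size-suc F e
... | i , p = suc i , p

size-≤ : (F : Face n) → size F ≤ n
size-≤ []          = z≤n
size-≤ (false ∷ F) = ℕ.≤-trans (size-≤ F) (ℕ.n≤1+n _)
size-≤ (true  ∷ F) = s≤s (size-≤ F)

∈-delete⁻ : {F : Face n} {u i : Fin n} → i ∈ F [ u ]≔ false → i ≢ u × i ∈ F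
∈-delete⁻ {F = F} {u} {i} p with i Fin.≟ u
... | no i≢u = i≢u , trans (sym (lookup∘update′ i≢u F false)) p
... | yes refl with trans (sym p) (lookup∘update u F false)
... | ()

-- The chain map induced by a colouring of the vertices; faces with a repeated colour vanish.
push : (Fin N → Fin n) → Chain N → Chain n
push col (pt b)     = if b then unit else 𝟘
push col (node c d) = push (col ∘ suc) c ⊕ μ (col zero) (push (col ∘ suc) d)

push-𝟘 : (col : Fin N → Fin n) → push col 𝟘 ≡ 𝟘
push-𝟘 {zero}  col = refl
push-𝟘 {suc N} col = trans (cong₂ _⊕_ (push-𝟘 (col ∘ suc))
  (trans (cong (μ (col zero)) (push-𝟘 (col ∘ suc))) (μ-𝟘 (col zero)))) (⊕-self 𝟘)

push-unit : (col : Fin N → Fin n) → push col unit ≡ unit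
push-unit {zero}  col = refl
push-unit {suc N} col = trans (cong₂ _⊕_ (push-unit (col ∘ suc))
  (trans (cong (μ (col zero)) (push-𝟘 (col ∘ suc))) (μ-𝟘 (col zero)))) (⊕-identityʳ unit)

push-⊕ : (col : Fin N → Fin n) (c d : Chain N) → push col (c ⊕ d) ≡ push col c ⊕ push col d
push-⊕ col (pt true)  (pt true)  = sym (⊕-self unit)
push-⊕ col (pt true)  (pt false) = sym (⊕-identityʳ unit)
push-⊕ col (pt false) (pt b)     = sym (⊕-identityˡ _)
push-⊕ col (node a a′) (node b b′) = begin
  push col′ (a ⊕ b) ⊕ μ u (push col′ (a′ ⊕ b′))
    ≡⟨ cong₂ _⊕_ (push-⊕ col′ a b) (trans (cong (μ u) (push-⊕ col′ a′ b′)) (μ-⊕ u _ _)) ⟩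
  (push col′ a ⊕ push col′ b) ⊕ (μ u (push col′ a′) ⊕ μ u (push col′ b′))
    ≡⟨ ⊕-interchange (push col′ a) (push col′ b) _ _ ⟩
  (push col′ a ⊕ μ u (push col′ a′)) ⊕ (push col′ b ⊕ μ u (push col′ b′)) ∎
  where
  open ≡-Reasoning
  col′ = col ∘ suc
  u = col zero

-- The cone formula holds for chains that already contain the apex, so faces with a repeated colour
-- need no case of their own.
push-∂ : (col : Fin N → Fin n) (c : Chain N) → push col (∂ c) ≡ ∂ (push col c)
push-∂ col (pt true)  = sym ∂-unit
push-∂ col (pt false) = sym ∂-𝟘
push-∂ col (node c d) = begin
  push col′ (∂ c ⊕ d) ⊕ μ u (push col′ (∂ d))
    ≡⟨ cong₂ _⊕_ (push-⊕ col′ (∂ c) d) (cong (μ u) (push-∂ col′ d)) ⟩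
  (push col′ (∂ c) ⊕ push col′ d) ⊕ μ u (∂ (push col′ d))
    ≡⟨ ⊕-assoc (push col′ (∂ c)) _ _ ⟩
  push col′ (∂ c) ⊕ (push col′ d ⊕ μ u (∂ (push col′ d)))
    ≡⟨ cong₂ _⊕_ (push-∂ col′ c) (sym (∂-μ u (push col′ d))) ⟩
  ∂ (push col′ c) ⊕ ∂ (μ u (push col′ d))
    ≡⟨ ∂-⊕ (push col′ c) _ ⟨
  ∂ (push col′ c ⊕ μ u (push col′ d)) ∎
  where
  open ≡-Reasoning
  col′ = col ∘ suc
  u = col zero

push-true : (col : Fin N → Fin n) (c : Chain N) (T : Face n) → coef (push col c) T ≡ true →
  ∃ λ F → coef c F ≡ true × (∀ i → i ∈ T → ∃ λ u → u ∈ F × col u ≡ i) × (∀ u → u ∈ F → col u ∈ T)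
push-true {n = n} col (pt true) T e = [] , refl ,
  (λ i i∈ → ⊥-elim (∈⇒¬∉ {F = T} i∈ (trans (cong (λ t → lookup t i) (unit-true T e)) (lookup-replicate i false)))) , λ ()
push-true col (pt false) T e with trans (sym e) (coef-𝟘 T)
... | ()
push-true col (node c d) T e with xor-true (trans (sym (coef-⊕ (push (col ∘ suc) c) _ T)) e)
... | inj₁ p with push-true (col ∘ suc) c T p
... | F , cF , hit , in-T = false ∷ F , cF , hit′ , λ { (suc u) → in-T u }
  where
  hit′ : ∀ i → i ∈ T → _
  hit′ i i∈ with hit i i∈
  ... | u , u∈ , eq = suc u , u∈ , eq
push-true col (node c d) T e | inj₂ p with coef-μ-true (col zero) (push (col ∘ suc) d) T p
... | c∈T , p′ with push-true (col ∘ suc) d _ p′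
... | F , cF , hit , in-T = true ∷ F , cF , hit′ , λ { zero _ → c∈T ; (suc u) u∈ → proj₂ (∈-delete⁻ {F = T} (in-T u u∈)) }
  where
  hit′ : ∀ i → i ∈ T → ∃ λ u → u ∈ (true ∷ F) × col u ≡ i
  hit′ i i∈ with i Fin.≟ col zero
  ... | yes refl = zero , refl , refl
  ... | no i≢ with hit i (trans (lookup∘update′ i≢ T false) i∈)
  ... | u , u∈ , eq = suc u , u∈ , eq

facet : (Face n → Chain N) → Face n → Fin n → Chain N
facet φ K j = if lookup K j then φ (K [ j ]≔ false) else 𝟘

facets : (Face n → Chain N) → Face n → Chain N
facets φ K = ⨁ (facet φ K)

facets-cong : {φ ψ : Face n → Chain N} (K : Face n) →
  (∀ j → j ∈ K → φ (K [ j ]≔ false) ≡ ψ (K [ j ]≔ false)) → facets φ K ≡ facets ψ K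
facets-cong {φ = φ} {ψ} K h = ⨁-cong lemma
  where
  lemma : ∀ j → facet φ K j ≡ facet ψ K j
  lemma j with lookup K j in eq
  ... | true  = h j eq
  ... | false = refl

∂-facets : (φ : Face n → Chain N) (K : Face n) →
  (∀ j → j ∈ K → ∂ (φ (K [ j ]≔ false)) ≡ facets φ (K [ j ]≔ false)) → ∂ (facets φ K) ≡ 𝟘
∂-facets {n} {N} φ K h = trans (⨁-hom ∂ ∂-𝟘 ∂-⊕ (facet φ K)) (trans (⨁-cong outer) (⨁-symmetric g symm diag))
  where
  g : Fin n → Fin n → Chain N
  g j i = if lookup K j then facet φ (K [ j ]≔ false) i else 𝟘
  outer : ∀ j → ∂ (facet φ K j) ≡ ⨁ (g j)
  outer j with lookup K j in eq
  ... | true  = h j eq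
  ... | false = trans ∂-𝟘 (sym (⨁-𝟘 n))
  diag : ∀ i → g i i ≡ 𝟘
  diag i with lookup K i
  ... | false = refl
  ... | true rewrite lookup∘update i K false = refl
  symm : ∀ i j → g i j ≡ g j i
  symm i j with i Fin.≟ j
  ... | yes refl = refl
  ... | no i≢j rewrite lookup∘update′ i≢j K false | lookup∘update′ (≢-sym i≢j) K false
                     | []≔-commutes {x = false} {y = false} K i j i≢j
      with lookup K i | lookup K j
  ... | true  | true  = refl
  ... | true  | false = refl
  ... | false | true  = refl
  ... | false | false = refl

-- Aharoni–Haxell–Meshulam: chains φ(K) with ∂ φ(K) = Σ φ(K ∖ j) exist by Fill, and pushing
-- them forward to the colours shows by induction that φ(K) has an odd number of K-rainbow faces.
module Rainbow (col : Fin N → Fin n) (X : Face n → Complex N)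
  (fill : ∀ K → Fill (X K) (size K))
  (X-mono : ∀ K j F → X (K [ j ]≔ false) F → X K F)
  (X-∅ : ∀ K → X K (replicate N false))
  (X-col : ∀ K F → X K F → ∀ u → u ∈ F → col u ∈ K) where

  Good : (Face n → Chain N) → Face n → Set
  Good φ K = φ K ⊑ (X K ofSize size K) × ∂ (φ K) ≡ facets φ K

  record Filling (s : ℕ) : Set where
    field
      φ    : Face n → Chain N
      φ-∅  : φ (replicate n false) ≡ unit
      good : ∀ K → size K ≤ s → Good φ K

  filling : ∀ s → Filling s
  -- Only the value at the empty set of colours is constrained here, so a constant function will do.
  filling zero = record { φ = λ _ → unit ; φ-∅ = refl ; good = good }
    where
    good : ∀ K → size K ≤ 0 → Good (λ _ → unit) K
    good K sz≤0 with size-zero K (ℕ.n≤0⇒n≡0 sz≤0)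
    ... | refl = (λ F e → subst (X _) (sym (unit-true F e)) (X-∅ _) ,
                          trans (cong size (unit-true F e)) (trans (size-∅ N) (sym (size-∅ n)))) ,
                 trans ∂-unit (sym (trans (⨁-cong {f = facet (λ _ → unit) (replicate n false)}
                   {g = λ _ → 𝟘} (λ j → cong (if_then unit else 𝟘) (lookup-replicate j false))) (⨁-𝟘 n)))
  filling (suc s) = record { φ = φ′ ; φ-∅ = trans (φ′-old _ (subst (_≤ s) (sym (size-∅ n)) z≤n)) φ-∅ ; good = good′ }
    where
    open Filling (filling s)

    delete-≤ : ∀ K t j → size K ≤ suc t → j ∈ K → size (K [ j ]≔ false) ≤ t
    delete-≤ K t j le j∈ = s≤s⁻¹ (subst (_≤ suc t) (size-delete K j j∈) le)

    -- The sum over the facets of `K` lives on faces of size `s`, the largest size that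
    -- `Fill (X K) (size K)` reaches.
    extend : ∀ K → size K ≡ suc s → Σ (Chain N) λ c → ∂ c ≡ facets φ K × c ⊑ (X K ofSize suc s)
    extend K sz = fill K s (subst (s <_) (sym sz) (ℕ.n<1+n s)) (facets φ K)
      (∂-facets φ K (λ j j∈ → proj₂ (good _ (delete-≤ K s j (ℕ.≤-reflexive sz) j∈))))
      (⊑-⨁ {f = facet φ K} term)
      where
      term : ∀ j → facet φ K j ⊑ (X K ofSize s)
      term j F e with lookup K j in eq
      ... | true with proj₁ (good _ (delete-≤ K s j (ℕ.≤-reflexive sz) eq)) F e
      ... | x , sz′ = X-mono K j F x , trans sz′ (suc-injective (trans (sym (size-delete K j eq)) sz))
      term j F e | false with trans (sym e) (coef-𝟘 F)
      ... | ()

    φ′ : Face n → Chain N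
    φ′ K with size K ℕ.≟ suc s
    ... | yes sz = proj₁ (extend K sz)
    ... | no  _  = φ K

    φ′-old : ∀ K → size K ≤ s → φ′ K ≡ φ K
    φ′-old K le with size K ℕ.≟ suc s
    ... | yes sz = ⊥-elim (ℕ.1+n≰n (subst (_≤ s) sz le))
    ... | no  _  = refl

    facets-old : ∀ K → size K ≤ suc s → facets φ K ≡ facets φ′ K
    facets-old K le = facets-cong {φ = φ} {φ′} K λ j j∈ → sym (φ′-old (K [ j ]≔ false) (delete-≤ K s j le j∈))

    good′ : ∀ K → size K ≤ suc s → Good φ′ K
    good′ K le with size K ℕ.≟ suc s
    ... | yes sz = (λ F e → let x , z = proj₂ (proj₂ (extend K sz)) F e in x , trans z (sym sz)) ,
                   trans (proj₁ (proj₂ (extend K sz))) (facets-old K le)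
    ... | no  sz with ℕ.m≤n⇒m<n∨m≡n le
    ... | inj₂ eq = ⊥-elim (sz eq)
    ... | inj₁ lt = proj₁ (good K (s≤s⁻¹ lt)) , trans (proj₂ (good K (s≤s⁻¹ lt))) (facets-old K le)

  open Filling (filling n)

  push-⊆ : ∀ K T → coef (push col (φ K)) T ≡ true → ∀ i → i ∈ T → i ∈ K
  push-⊆ K T e i i∈ with push-true col (φ K) T e
  ... | F , cF , hit , _ with hit i i∈
  ... | u , u∈ , refl = X-col K F (proj₁ (proj₁ (good K (size-≤ K)) F cF)) u u∈

  -- Push `∂ (φ K)` forward and read off the coefficient at `K` without `i`. As the boundary of a
  -- chain with colours in `K`, it sees only the face `K`; as a sum over facets it sees only the
  -- summand `i`, since every other summand misses a colour of the face. The parity therefore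
  -- descends to the empty set, where it is 1.
  odd : ∀ s K → size K ≡ s → coef (push col (φ K)) K ≡ true
  odd zero K sz with size-zero K sz
  ... | refl = trans (cong (λ c → coef c K) (trans (cong (push col) φ-∅) (push-unit col))) (coef-unit n)
  odd (suc s) K sz with size-suc K sz
  ... | i , i∈ = begin
    coef (push col (φ K)) K
      ≡⟨ cong (coef (push col (φ K))) (insert-delete K i i∈) ⟨
    coef (push col (φ K)) (T [ i ]≔ true)
      ≡⟨ coef-∂-single (push col (φ K)) T i (lookup∘update i K false) others-∂ ⟨
    coef (∂ (push col (φ K))) T
      ≡⟨ cong (λ c → coef c T) (push-∂ col (φ K)) ⟨
    coef (push col (∂ (φ K))) T
      ≡⟨ cong (λ c → coef (push col c) T) (proj₂ (good K (size-≤ K))) ⟩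
    coef (push col (facets φ K)) T
      ≡⟨ cong (λ c → coef c T) (⨁-hom (push col) (push-𝟘 col) (push-⊕ col) (facet φ K)) ⟩
    coef (⨁ (push col ∘ facet φ K)) T
      ≡⟨ coef-⨁-single (push col ∘ facet φ K) T i others-⨁ ⟩
    coef (push col (facet φ K i)) T
      ≡⟨ cong (λ b → coef (push col (if b then φ T else 𝟘)) T) i∈ ⟩
    coef (push col (φ T)) T
      ≡⟨ odd s T (suc-injective (trans (sym (size-delete K i i∈)) sz)) ⟩
    true ∎
    where
    open ≡-Reasoning
    T = K [ i ]≔ false
    others-∂ : ∀ j → j ≢ i → j ∉ T → coef (push col (φ K)) (T [ j ]≔ true) ≡ false
    others-∂ j j≢i j∉ = ¬-not λ e → ∈⇒¬∉ {F = T}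
      (trans (lookup∘update′ j≢i K false) (push-⊆ K _ e j (∈-self {F = T}))) j∉
    others-⨁ : ∀ j → j ≢ i → coef (push col (facet φ K j)) T ≡ false
    others-⨁ j j≢i with lookup K j in eq
    ... | false = trans (cong (λ c → coef c T) (push-𝟘 col)) (coef-𝟘 T)
    ... | true  = ¬-not λ e → ∈⇒¬∉ {F = K [ j ]≔ false}
      (push-⊆ (K [ j ]≔ false) T e j (trans (lookup∘update′ j≢i K false) eq)) (lookup∘update j K false)

  rainbow : ∀ K → ∃ λ F → X K F × (∀ i → i ∈ K → ∃ λ u → u ∈ F × col u ≡ i)
  rainbow K with push-true col (φ K) K (odd _ K refl)
  ... | F , cF , hit , _ = F , proj₁ (proj₁ (good K (size-≤ K)) F cF) , hit

-- Nonnegative integer tables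

sum-mono : {f g : Fin n → ℕ} → (∀ i → f i ≤ g i) → sum f ≤ sum g
sum-mono {zero}  h = z≤n
sum-mono {suc n} h = ℕ.+-mono-≤ (h zero) (sum-mono (h ∘ suc))

sum-mono-< : {f g : Fin n → ℕ} → (∀ i → f i ≤ g i) → ∀ i → f i < g i → sum f < sum g
sum-mono-< {suc n} h zero    lt = ℕ.+-mono-<-≤ lt (sum-mono (h ∘ suc))
sum-mono-< {suc n} h (suc i) lt = ℕ.+-mono-≤-< (h zero) (sum-mono-< (h ∘ suc) i lt)

sum-zero : {f : Fin n → ℕ} → (∀ i → f i ≡ 0) → sum f ≡ 0
sum-zero {n} h = trans (sum-cong-≗ h) (sum-replicate-zero n)

term≤sum : (f : Fin n → ℕ) (i : Fin n) → f i ≤ sum f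
term≤sum f zero    = ℕ.m≤m+n _ _
term≤sum f (suc i) = ℕ.≤-trans (term≤sum (f ∘ suc) i) (ℕ.m≤n+m _ _)

sum-positive : (f : Fin n → ℕ) → 0 < sum f → ∃ λ i → 0 < f i
sum-positive {suc n} f h with f zero in eq
... | suc _ = zero , subst (0 <_) (sym eq) z<s
... | zero with sum-positive (f ∘ suc) h
... | i , lt = suc i , lt

sum-single : (f : Fin n → ℕ) (i : Fin n) → (∀ j → j ≢ i → f j ≡ 0) → sum f ≡ f i
sum-single {suc n} f i h = trans (sum-remove {i = i} f)
  (trans (cong (f i +_) (sum-zero λ j → h (punchIn i j) (punchInᵢ≢i i j))) (ℕ.+-identityʳ _))

sum-other : (f : Fin n → ℕ) (i : Fin n) → sum f ≢ f i → ∃ λ j → j ≢ i × 0 < f j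
sum-other f i h with any? (λ j → ¬? (j Fin.≟ i) ×-dec (0 ℕ.<? f j))
... | yes w = w
... | no ¬w = ⊥-elim (h (sum-single f i λ j j≢i → ℕ.n≤0⇒n≡0 (ℕ.≮⇒≥ λ lt → ¬w (j , j≢i , lt))))

sum-rest : (f : Fin n → ℕ) (i : Fin n) → sum f ≡ f i → ∀ j → j ≢ i → f j ≡ 0
sum-rest {suc n} f i eq j j≢i = ℕ.n≤0⇒n≡0 (begin
  f j                               ≡⟨ cong f (punchIn-punchOut (≢-sym j≢i)) ⟨
  f (punchIn i (punchOut (≢-sym j≢i))) ≤⟨ term≤sum (λ t → f (punchIn i t)) (punchOut (≢-sym j≢i)) ⟩
  sum (λ t → f (punchIn i t))       ≡⟨ ℕ.+-cancelˡ-≡ (f i) _ 0 (trans (sym (sum-remove {i = i} f)) (trans eq (sym (ℕ.+-identityʳ _)))) ⟩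
  0                                 ∎)
  where open ℕ.≤-Reasoning

sum-drop : (f g : Fin n → ℕ) (i : Fin n) → (∀ j → j ≢ i → g j ≡ f j) → sum f ≤ sum g + f i
sum-drop {suc n} f g i h = begin
  sum f                                ≡⟨ sum-remove {i = i} f ⟩
  f i + sum (λ j → f (punchIn i j))    ≡⟨ cong (f i +_) (sum-cong-≗ λ j → h _ (punchInᵢ≢i i j)) ⟨
  f i + sum (λ j → g (punchIn i j))    ≤⟨ ℕ.+-monoʳ-≤ (f i) (ℕ.m≤n+m _ (g i)) ⟩
  f i + (g i + sum (λ j → g (punchIn i j))) ≡⟨ cong (f i +_) (sum-remove {i = i} g) ⟨
  f i + sum g                          ≡⟨ ℕ.+-comm (f i) _ ⟩
  sum g + f i                          ∎
  where open ℕ.≤-Reasoning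

δ : Fin n → Fin n → ℕ
δ i j = if does (i Fin.≟ j) then 1 else 0

δ-refl : (i : Fin n) → δ i i ≡ 1
δ-refl i with i Fin.≟ i
... | yes _ = refl
... | no ¬p = ⊥-elim (¬p refl)

δ-≢ : {i j : Fin n} → i ≢ j → δ i j ≡ 0
δ-≢ {i = i} {j} h with i Fin.≟ j
... | yes p = ⊥-elim (h p)
... | no _  = refl

δ-≤1 : (i j : Fin n) → δ i j ≤ 1
δ-≤1 i j with i Fin.≟ j
... | yes _ = ℕ.≤-refl
... | no _  = z≤n

sum-δʳ : (m : ℕ) (i : Fin n) → sum (λ j → m * δ i j) ≡ m
sum-δʳ m i = trans (sum-single (λ j → m * δ i j) i (λ j j≢i → trans (cong (m *_) (δ-≢ (≢-sym j≢i))) (ℕ.*-zeroʳ m)))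
                   (trans (cong (m *_) (δ-refl i)) (ℕ.*-identityʳ m))

sum-δˡ : (m : ℕ) (i : Fin n) → sum (λ j → δ i j * m) ≡ m
sum-δˡ m i = trans (sum-cong-≗ λ j → ℕ.*-comm (δ i j) m) (sum-δʳ m i)

δ*δ-positive : (i i′ : Fin n) (j j′ : Fin p) → 0 < δ i i′ * δ j j′ → i ≡ i′ × j ≡ j′
δ*δ-positive i i′ j j′ h with i Fin.≟ i′ | j Fin.≟ j′
... | yes p | yes q = p , q

Table : ℕ → ℕ → Set
Table p q = Fin p → Fin q → ℕ

rowSum : Table p q → Fin p → ℕ
rowSum x b = sum (x b)

colSum : Table p q → Fin q → ℕ
colSum x c = sum λ b → x b c

total : Table p q → ℕ
total x = sum (rowSum x)

total-cols : (x : Table p q) → total x ≡ sum (colSum x)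
total-cols x = ∑-comm x

-- The potential for cancelling cycles: every cancellation increases it, while the margins, and with
-- them the bound `total x * total x`, stay fixed.
squares : Table p q → ℕ
squares x = total λ b c → x b c * x b c

sum-squares : (f : Fin n → ℕ) → sum (λ i → f i * f i) ≤ sum f * sum f
sum-squares {zero}  f = z≤n
sum-squares {suc n} f = begin
  a * a + sum (λ i → f (suc i) * f (suc i)) ≤⟨ ℕ.+-monoʳ-≤ (a * a) (sum-squares (f ∘ suc)) ⟩
  a * a + s * s                             ≤⟨ ℕ.m≤m+n _ (2 * a * s) ⟩
  a * a + s * s + 2 * a * s                 ≡⟨ solve 2 (λ a s → a :* a :+ s :* s :+ con 2 :* a :* s := (a :+ s) :* (a :+ s)) refl a s ⟩
  (a + s) * (a + s)                         ∎
  where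
  open ℕ.≤-Reasoning
  open +-*-Solver
  a = f zero
  s = sum (f ∘ suc)

squares≤total² : (x : Table p q) → squares x ≤ total x * total x
squares≤total² x = ℕ.≤-trans (sum-mono λ b → sum-squares (x b)) (sum-squares (rowSum x))

-- Leaves and the cancelling of alternating cycles

IsLeaf : Table p q → Fin p → Fin q → Set
IsLeaf x b c = 0 < x b c × (rowSum x b ≡ x b c ⊎ colSum x c ≡ x b c)

-- The support may only shrink, so that an edge covering a cell of the old table is available for
-- the new one.
record SameMargins (x y : Table p q) : Set where
  field
    rows    : ∀ b → rowSum y b ≡ rowSum x b
    cols    : ∀ c → colSum y c ≡ colSum x c
    support : ∀ b c → 0 < y b c → 0 < x b c

-- The parallelogram identity with k = |a - x|, stated without subtraction.
square-midpoint : ∀ a b x → a + b ≡ x + x →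
  ∃ λ k → (x * x + x * x) + 2 * (k * k) ≡ a * a + b * b × (k ≡ 0 → a ≡ x)
square-midpoint a b x eq with ℕ.≤-total a x
... | inj₁ a≤x with ℕ.m≤n⇒∃[o]m+o≡n a≤x
... | k , refl with ℕ.+-cancelˡ-≡ a b (k + (a + k)) (trans eq (ℕ.+-assoc a k (a + k)))
... | refl = k , solve 2 (λ a k → (a :+ k) :* (a :+ k) :+ (a :+ k) :* (a :+ k) :+ con 2 :* (k :* k)
                    := a :* a :+ (k :+ (a :+ k)) :* (k :+ (a :+ k))) refl a k ,
             λ { refl → sym (ℕ.+-identityʳ a) }
  where open +-*-Solver
square-midpoint a b x eq | inj₂ x≤a with ℕ.m≤n⇒∃[o]m+o≡n x≤a
... | k , refl with ℕ.+-cancelˡ-≡ x x (k + b) (trans (sym eq) (ℕ.+-assoc x k b))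
... | refl = k , solve 2 (λ b k → (k :+ b) :* (k :+ b) :+ (k :+ b) :* (k :+ b) :+ con 2 :* (k :* k)
                    := (k :+ b :+ k) :* (k :+ b :+ k) :+ b :* b) refl b k ,
             λ { refl → ℕ.+-identityʳ x }
  where open +-*-Solver

square-midpoint-≤ : ∀ a b x → a + b ≡ x + x → x * x + x * x ≤ a * a + b * b
square-midpoint-≤ a b x eq with square-midpoint a b x eq
... | k , e , _ = subst (x * x + x * x ≤_) e (ℕ.m≤m+n _ (2 * (k * k)))

square-midpoint-< : ∀ a b x → a + b ≡ x + x → a ≢ x → x * x + x * x < a * a + b * b
square-midpoint-< a b x eq a≢x with square-midpoint a b x eq
... | zero  , _ , h = ⊥-elim (a≢x (h refl))
... | suc k , e , _ = subst (x * x + x * x <_) e (ℕ.m<m+n _ z<s)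

-- The truncated subtraction in `shift` is exact because `z` is at most `x`, and cells where `x`
-- vanishes stay zero because `y` vanishes there too.
module Shift (x y z : Table p q) (y≤x : ∀ b c → y b c ≤ x b c) (z≤x : ∀ b c → z b c ≤ x b c)
             (rows : ∀ b → rowSum y b ≡ rowSum z b) (cols : ∀ c → colSum y c ≡ colSum z c) where

  shift : Table p q
  shift b c = x b c + y b c ∸ z b c

  shift-+ : ∀ b c → shift b c + z b c ≡ x b c + y b c
  shift-+ b c = ℕ.m∸n+n≡m (ℕ.≤-trans (z≤x b c) (ℕ.m≤m+n _ _))

  cancel : (f g u v : Fin n → ℕ) → (∀ i → f i + v i ≡ g i + u i) → sum u ≡ sum v → sum f ≡ sum g
  cancel f g u v h eq = ℕ.+-cancelʳ-≡ (sum v) (sum f) (sum g) (begin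
    sum f + sum v              ≡⟨ ∑-distrib-+ f v ⟨
    sum (λ i → f i + v i)      ≡⟨ sum-cong-≗ h ⟩
    sum (λ i → g i + u i)      ≡⟨ ∑-distrib-+ g u ⟩
    sum g + sum u              ≡⟨ cong (sum g +_) eq ⟩
    sum g + sum v              ∎)
    where open ≡-Reasoning

  shift-margins : SameMargins x shift
  shift-margins = record
    { rows    = λ b → cancel (shift b) (x b) (y b) (z b) (shift-+ b) (rows b)
    ; cols    = λ c → cancel _ _ (λ b → y b c) (λ b → z b c) (λ b → shift-+ b c) (cols c)
    ; support = supp
    }
    where
    supp : ∀ b c → 0 < shift b c → 0 < x b c
    supp b c lt with x b c in eq
    ... | suc _ = z<s
    ... | zero  = ⊥-elim (ℕ.n≮0 (ℕ.<-≤-trans lt (ℕ.≤-trans (ℕ.m∸n≤m (y b c) (z b c)) (subst (y b c ≤_) eq (y≤x b c)))))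

-- The tables x + y - z and x + z - y have midpoint `x` and differ from it at (b₀ , c₀), so by
-- strict convexity at least one of them has a larger sum of squares.
squares-grow : (x y z : Table p q) → (∀ b c → y b c ≤ x b c) → (∀ b c → z b c ≤ x b c) →
  (∀ b → rowSum y b ≡ rowSum z b) → (∀ c → colSum y c ≡ colSum z c) →
  ∀ b₀ c₀ → y b₀ c₀ ≢ z b₀ c₀ → ∃ λ x′ → SameMargins x x′ × squares x < squares x′
squares-grow x y z y≤x z≤x rows cols b₀ c₀ y≢z = choose (squares x ℕ.<? squares A) (squares x ℕ.<? squares B)
  where
  module A = Shift x y z y≤x z≤x rows cols
  module B = Shift x z y z≤x y≤x (sym ∘ rows) (sym ∘ cols)
  A = A.shift
  B = B.shift

  mid : ∀ b c → A b c + B b c ≡ x b c + x b c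
  mid b c = ℕ.+-cancelʳ-≡ (z b c + y b c) _ _ (begin
    (A b c + B b c) + (z b c + y b c) ≡⟨ solve 4 (λ a b c d → (a :+ b) :+ (c :+ d) := (a :+ c) :+ (b :+ d)) refl (A b c) (B b c) (z b c) (y b c) ⟩
    (A b c + z b c) + (B b c + y b c) ≡⟨ cong₂ _+_ (A.shift-+ b c) (B.shift-+ b c) ⟩
    (x b c + y b c) + (x b c + z b c) ≡⟨ solve 3 (λ x y z → (x :+ y) :+ (x :+ z) := (x :+ x) :+ (z :+ y)) refl (x b c) (y b c) (z b c) ⟩
    (x b c + x b c) + (z b c + y b c) ∎)
    where
    open ≡-Reasoning
    open +-*-Solver

  A≢x : A b₀ c₀ ≢ x b₀ c₀
  A≢x eq = y≢z (sym (ℕ.+-cancelˡ-≡ (x b₀ c₀) _ _ (trans (cong (_+ z b₀ c₀) (sym eq)) (A.shift-+ b₀ c₀))))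

  double : (u v : Table p q) → total (λ b c → u b c + v b c) ≡ total u + total v
  double u v = trans (sum-cong-≗ λ b → ∑-distrib-+ (u b) (v b)) (∑-distrib-+ (rowSum u) (rowSum v))

  grow : squares x + squares x < squares A + squares B
  grow = subst₂ _<_ (double (λ b c → x b c * x b c) (λ b c → x b c * x b c))
                   (double (λ b c → A b c * A b c) (λ b c → B b c * B b c))
    (sum-mono-< (λ b → sum-mono λ c → square-midpoint-≤ (A b c) (B b c) (x b c) (mid b c)) b₀
      (sum-mono-< (λ c → square-midpoint-≤ (A b₀ c) (B b₀ c) (x b₀ c) (mid b₀ c)) c₀
        (square-midpoint-< (A b₀ c₀) (B b₀ c₀) (x b₀ c₀) (mid b₀ c₀) A≢x)))

  choose : Dec (squares x < squares A) → Dec (squares x < squares B) → ∃ λ x′ → SameMargins x x′ × squares x < squares x′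
  choose (yes lt) _ = A , A.shift-margins , lt
  choose (no _) (yes lt) = B , B.shift-margins , lt
  choose (no ¬a) (no ¬b) = ⊥-elim (ℕ.<⇒≱ grow (ℕ.+-mono-≤ (ℕ.≮⇒≥ ¬a) (ℕ.≮⇒≥ ¬b)))

FirstRepeat : (ℕ → Fin p) → Set
FirstRepeat f = ∃₂ λ i ℓ → f (i + suc ℓ) ≡ f i ×
  (∀ s t → s < suc ℓ → t < suc ℓ → f (i + s) ≡ f (i + t) → s ≡ t)

-- Stopping at the first index whose value has occurred before keeps all earlier values distinct;
-- the pigeonhole principle bounds the search by p + 1 steps.
first-repeat : (f : ℕ → Fin p) → FirstRepeat f
first-repeat {p} f = search (suc p) 0 (ℕ.+-identityʳ _) (λ _ _ ())
  where
  search : ∀ fuel j → fuel + j ≡ suc p → (∀ s t → s < j → t < j → f s ≡ f t → s ≡ t) → FirstRepeat f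
  search zero j refl inj with pigeonhole (ℕ.n<1+n p) (f ∘ toℕ)
  ... | s , t , s<t , eq = ⊥-elim (ℕ.<-irrefl (inj _ _ (toℕ<n s) (toℕ<n t) eq) s<t)
  search (suc fuel) j eq inj with any? {n = j} (λ i → f j Fin.≟ f (toℕ i))
  ... | no ¬rep = search fuel (suc j) (trans (ℕ.+-suc fuel j) eq) inj′
    where
    inj′ : ∀ s t → s < suc j → t < suc j → f s ≡ f t → s ≡ t
    inj′ s t s≤j t≤j e with ℕ.m<1+n⇒m<n∨m≡n s≤j | ℕ.m<1+n⇒m<n∨m≡n t≤j
    ... | inj₁ s<j  | inj₁ t<j  = inj s t s<j t<j e
    ... | inj₂ refl | inj₂ refl = refl
    ... | inj₂ refl | inj₁ t<j  = ⊥-elim (¬rep (fromℕ< t<j , trans e (cong f (sym (toℕ-fromℕ< t<j)))))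
    ... | inj₁ s<j  | inj₂ refl = ⊥-elim (¬rep (fromℕ< s<j , trans (sym e) (cong f (sym (toℕ-fromℕ< s<j)))))
  ... | yes (i , e) with ℕ.m≤n⇒∃[o]m+o≡n (toℕ<n i)
  ... | ℓ , j≡ = toℕ i , ℓ , trans (cong f i+ℓ≡j) e ,
    λ s t s≤ℓ t≤ℓ r → ℕ.+-cancelˡ-≡ (toℕ i) s t (inj _ _ (bound s s≤ℓ) (bound t t≤ℓ) r)
    where
    i+ℓ≡j : toℕ i + suc ℓ ≡ j
    i+ℓ≡j = trans (ℕ.+-suc (toℕ i) ℓ) j≡
    bound : ∀ s → s < suc ℓ → toℕ i + s < j
    bound s lt = subst (toℕ i + s <_) i+ℓ≡j (ℕ.+-monoʳ-< (toℕ i) lt)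

-- A closed alternating walk through the support in which no row repeats: adding the visits
-- (b t , c t) and removing the visits (b (t+1) , c t) preserves all margins.
module ClosedWalk (x : Table p q) (ℓ : ℕ) (b : ℕ → Fin p) (c : ℕ → Fin q)
  (pos₁ : ∀ t → 0 < x (b t) (c t)) (pos₂ : ∀ t → 0 < x (b (suc t)) (c t))
  (b-step : b 1 ≢ b 0) (c-step : c 1 ≢ c 0)
  (closed : b (suc ℓ) ≡ b 0) (inj : ∀ s t → s < suc ℓ → t < suc ℓ → b s ≡ b t → s ≡ t) where

  visits : (ℕ → Fin p) → Table p q
  visits r i j = sum {suc ℓ} λ t → δ (r (toℕ t)) i * δ (c (toℕ t)) j

  visits-row : ∀ r i → rowSum (visits r) i ≡ sum {suc ℓ} (λ t → δ (r (toℕ t)) i)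
  visits-row r i = trans (∑-comm {_} {suc ℓ} (λ j t → δ (r (toℕ t)) i * δ (c (toℕ t)) j))
    (sum-cong-≗ {suc ℓ} λ t → sum-δʳ (δ (r (toℕ t)) i) (c (toℕ t)))

  visits-col : ∀ r j → colSum (visits r) j ≡ sum {suc ℓ} (λ t → δ (c (toℕ t)) j)
  visits-col r j = trans (∑-comm {_} {suc ℓ} (λ i t → δ (r (toℕ t)) i * δ (c (toℕ t)) j))
    (sum-cong-≗ {suc ℓ} λ t → sum-δˡ (δ (c (toℕ t)) j) (r (toℕ t)))

  -- Distinct rows mean that no cell is visited twice, and a visited cell has an entry of at least
  -- 1.
  visits-≤ : ∀ r → (∀ s t → s < suc ℓ → t < suc ℓ → r s ≡ r t → s ≡ t) → (∀ t → 0 < x (r t) (c t)) →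
             ∀ i j → visits r i j ≤ x i j
  visits-≤ r r-inj pos i j with 0 ℕ.<? visits r i j
  ... | no ¬p = ℕ.≤-trans (ℕ.≮⇒≥ ¬p) z≤n
  ... | yes v>0 with sum-positive {suc ℓ} _ v>0
  ... | t , t>0 with δ*δ-positive (r (toℕ t)) i (c (toℕ t)) j t>0
  ... | refl , refl = ℕ.≤-trans (ℕ.≤-reflexive (sum-single {suc ℓ} _ t others))
                        (ℕ.≤-trans (ℕ.*-mono-≤ (δ-≤1 (r (toℕ t)) i) (δ-≤1 (c (toℕ t)) j)) (pos (toℕ t)))
    where
    others : ∀ s → s ≢ t → δ (r (toℕ s)) (r (toℕ t)) * δ (c (toℕ s)) (c (toℕ t)) ≡ 0
    others s s≢t rewrite δ-≢ {i = r (toℕ s)} {r (toℕ t)} (λ e → s≢t (toℕ-injective (r-inj _ _ (toℕ<n s) (toℕ<n t) e))) = refl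

  b⁺ : ℕ → Fin p
  b⁺ t = b (suc t)

  b⁺-inj : ∀ s t → s < suc ℓ → t < suc ℓ → b⁺ s ≡ b⁺ t → s ≡ t
  b⁺-inj s t s≤ℓ t≤ℓ e with ℕ.m<1+n⇒m<n∨m≡n s≤ℓ | ℕ.m<1+n⇒m<n∨m≡n t≤ℓ
  ... | inj₁ s<ℓ  | inj₁ t<ℓ  = ℕ.suc-injective (inj _ _ (s<s s<ℓ) (s<s t<ℓ) e)
  ... | inj₂ refl | inj₂ refl = refl
  ... | inj₁ s<ℓ  | inj₂ refl with inj _ _ (s<s s<ℓ) z<s (trans e closed)
  ... | ()
  b⁺-inj s t s≤ℓ t≤ℓ e | inj₂ refl | inj₁ t<ℓ with inj _ _ z<s (s<s t<ℓ) (trans (sym closed) e)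
  ... | ()

  rows : ∀ i → rowSum (visits b) i ≡ rowSum (visits b⁺) i
  rows i = trans (visits-row b i) (trans rotate (sym (visits-row b⁺ i)))
    where
    open ≡-Reasoning
    g : ℕ → ℕ
    g t = δ (b t) i
    rotate : sum {suc ℓ} (g ∘ toℕ) ≡ sum {suc ℓ} (g ∘ suc ∘ toℕ)
    rotate = begin
      g 0 + sum {ℓ} (λ t → g (suc (toℕ t)))                     ≡⟨ ℕ.+-comm (g 0) _ ⟩
      sum {ℓ} (λ t → g (suc (toℕ t))) + g 0                     ≡⟨ cong₂ _+_ (sum-cong-≗ {ℓ} λ t → cong (g ∘ suc) (sym (toℕ-inject₁ t)))
                                                                     (trans (cong (λ r → δ r i) (sym closed)) (cong (g ∘ suc) (sym (toℕ-fromℕ ℓ)))) ⟩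
      sum {ℓ} (λ t → g (suc (toℕ (inject₁ t)))) + g (suc (toℕ (fromℕ ℓ))) ≡⟨ sum-init-last {ℓ} (g ∘ suc ∘ toℕ) ⟨
      sum {suc ℓ} (g ∘ suc ∘ toℕ)                               ∎

  -- The added visits contain this cell at time 1. The removed visits enter row `b 1` only at time
  -- 0, in column `c 0`, which is another column.
  differ : visits b (b 1) (c 1) ≢ visits b⁺ (b 1) (c 1)
  differ eq with sum-positive {suc ℓ} _ (subst (0 <_) eq visit>0)
    where
    1<ℓ : 1 < suc ℓ
    1<ℓ = s<s (ℕ.n≢0⇒n>0 λ ℓ≡0 → b-step (trans (cong (b ∘ suc) (sym ℓ≡0)) closed))
    t₁ : Fin (suc ℓ)
    t₁ = fromℕ< 1<ℓ
    one : δ (b (toℕ t₁)) (b 1) * δ (c (toℕ t₁)) (c 1) ≡ 1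
    one rewrite toℕ-fromℕ< 1<ℓ | δ-refl (b 1) | δ-refl (c 1) = refl
    visit>0 : 0 < visits b (b 1) (c 1)
    visit>0 = ℕ.<-≤-trans (subst (0 <_) (sym one) z<s) (term≤sum {suc ℓ} (λ t → δ (b (toℕ t)) (b 1) * δ (c (toℕ t)) (c 1)) t₁)
  ... | t , t>0 with δ*δ-positive (b⁺ (toℕ t)) (b 1) (c (toℕ t)) (c 1) t>0
  ... | b≡ , c≡ = c-step (trans (sym c≡) (cong c (b⁺-inj (toℕ t) 0 (toℕ<n t) z<s b≡)))

  cancel : ∃ λ x′ → SameMargins x x′ × squares x < squares x′
  cancel = squares-grow x (visits b) (visits b⁺) (visits-≤ b inj pos₁) (visits-≤ b⁺ b⁺-inj pos₂)
    rows (λ j → trans (visits-col b j) (sym (visits-col b⁺ j))) (b 1) (c 1) differ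

leaf? : (x : Table p q) → Dec (∃₂ λ b c → IsLeaf x b c)
leaf? x = any? λ b → any? λ c → (0 ℕ.<? x b c) ×-dec ((rowSum x b ℕ.≟ x b c) ⊎-dec (colSum x c ℕ.≟ x b c))

-- A positive entry that is not a leaf has a second positive entry in its row and another in its
-- column, so an alternating walk never gets stuck.
module Walk (x : Table p q) (no-leaf : ¬ ∃₂ λ b c → IsLeaf x b c) (b₀ : Fin p) (c₀ : Fin q) (pos₀ : 0 < x b₀ c₀) where

  Entry : Set
  Entry = ∃₂ λ b c → 0 < x b c

  other-row : ((b , c , _) : Entry) → ∃ λ b′ → b′ ≢ b × 0 < x b′ c
  other-row (b , c , pos) = sum-other (λ b′ → x b′ c) b (λ e → no-leaf (b , c , pos , inj₂ e))

  other-col : ((b , c , _) : Entry) → ∃ λ c′ → c′ ≢ c × 0 < x b c′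
  other-col (b , c , pos) = sum-other (x b) c (λ e → no-leaf (b , c , pos , inj₁ e))

  turn next : Entry → Entry
  turn e@(b , c , _) = let b′ , _ , pos = other-row e in b′ , c , pos
  next e = let b , _ = turn e ; c , _ , pos = other-col (turn e) in b , c , pos

  walk : ℕ → Entry
  walk zero    = b₀ , c₀ , pos₀
  walk (suc t) = next (walk t)

  growing : ∃ λ x′ → SameMargins x x′ × squares x < squares x′
  growing with first-repeat (proj₁ ∘ walk)
  ... | i , ℓ , closed , inj = ClosedWalk.cancel x ℓ (λ t → proj₁ (walk (i + t))) (λ t → proj₁ (proj₂ (walk (i + t))))
    (λ t → proj₂ (proj₂ (walk (i + t))))
    (λ t → subst (λ s → 0 < x (proj₁ (walk s)) (proj₁ (proj₂ (walk (i + t))))) (sym (ℕ.+-suc i t)) (proj₂ (proj₂ (other-row (walk (i + t))))))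
    (subst₂ (λ s t → proj₁ (walk s) ≢ proj₁ (walk t)) (ℕ.+-comm 1 i) (sym (ℕ.+-identityʳ i)) (proj₁ (proj₂ (other-row (walk i)))))
    (subst₂ (λ s t → proj₁ (proj₂ (walk s)) ≢ proj₁ (proj₂ (walk t))) (ℕ.+-comm 1 i) (sym (ℕ.+-identityʳ i))
      (proj₁ (proj₂ (other-col (turn (walk i))))))
    (trans closed (cong (proj₁ ∘ walk) (sym (ℕ.+-identityʳ i)))) inj

SameMargins-trans : {x y z : Table p q} → SameMargins x y → SameMargins y z → SameMargins x z
SameMargins-trans s t = record
  { rows    = λ b → trans (rows t b) (rows s b)
  ; cols    = λ c → trans (cols t c) (cols s c)
  ; support = λ b c → support s b c ∘ support t b c
  }
  where open SameMargins

SameMargins-total : {x y : Table p q} → SameMargins x y → total y ≡ total x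
SameMargins-total s = sum-cong-≗ (SameMargins.rows s)

with-leaf : (x : Table p q) → 0 < total x → ∃ λ x′ → SameMargins x x′ × ∃₂ λ b c → IsLeaf x′ b c
with-leaf {p} {q} x pos = search (total x * total x) x pos (ℕ.m≤n+m _ _)
  where
  search : ∀ fuel (x : Table p q) → 0 < total x → total x * total x ≤ squares x + fuel →
           ∃ λ x′ → SameMargins x x′ × ∃₂ λ b c → IsLeaf x′ b c
  search fuel x pos le with leaf? x
  ... | yes leaf = x , record { rows = λ _ → refl ; cols = λ _ → refl ; support = λ _ _ p → p } , leaf
  ... | no no-leaf with sum-positive (rowSum x) pos
  ... | b , pos-b with sum-positive (x b) pos-b
  ... | c , pos-bc with Walk.growing x no-leaf b c pos-bc
  ... | y , x~y , lt with fuel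
  ... | zero = ⊥-elim (ℕ.<⇒≱ lt (ℕ.≤-trans (squares≤total² y) (subst (λ t → t * t ≤ squares x)
                 (sym (SameMargins-total x~y)) (subst (total x * total x ≤_) (ℕ.+-identityʳ _) le))))
  ... | suc fuel′ with search fuel′ y (subst (0 <_) (sym (SameMargins-total x~y)) pos)
                     (subst (λ t → t * t ≤ squares y + fuel′) (sym (SameMargins-total x~y))
                       (ℕ.≤-trans le (ℕ.≤-trans (ℕ.≤-reflexive (ℕ.+-suc _ fuel′)) (ℕ.+-monoˡ-≤ fuel′ lt))))
  ... | z , y~z , leaf = z , SameMargins-trans x~y y~z , leaf

-- Connectivity of matching complexes from weights

module WeightedFill {N p q : ℕ} {R S : Set} (_≟R_ : DecidableEquality R) (_≟S_ : DecidableEquality S)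
  (row : Fin N → R) (col : Fin N → S)
  (ρ : Fin p → R) (ρ-inj : Injective _≡_ _≡_ ρ) (κ : Fin q → S) (κ-inj : Injective _≡_ _≡_ κ) where

  open LineGraph _≟R_ _≟S_ row col

  private
    variable
      r : R
      s : S

  -- The line is named in `R`, not in `Fin p`, because the edge `f` of an exchange may lie on a line
  -- outside the table; killing such a line changes nothing.
  killRow : R → Table p q → Table p q
  killRow r x b c = if does (ρ b ≟R r) then 0 else x b c

  killCol : S → Table p q → Table p q
  killCol s x b c = if does (κ c ≟S s) then 0 else x b c

  killRow-≤ : ∀ r x b c → killRow r x b c ≤ x b c
  killRow-≤ r x b c with ρ b ≟R r
  ... | yes _ = z≤n
  ... | no _  = ℕ.≤-refl

  killCol-≤ : ∀ s x b c → killCol s x b c ≤ x b c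
  killCol-≤ s x b c with κ c ≟S s
  ... | yes _ = z≤n
  ... | no _  = ℕ.≤-refl

  killRow-≢ : ∀ x b c → 0 < killRow r x b c → ρ b ≢ r
  killRow-≢ {r} x b c lt with ρ b ≟R r
  ... | no h = h

  killCol-≢ : ∀ x b c → 0 < killCol s x b c → κ c ≢ s
  killCol-≢ {s} x b c lt with κ c ≟S s
  ... | no h = h

  killRow-old : ∀ x b c → ρ b ≢ r → killRow r x b c ≡ x b c
  killRow-old {r} x b c h with ρ b ≟R r
  ... | yes e = ⊥-elim (h e)
  ... | no _  = refl

  killCol-old : ∀ x b c → κ c ≢ s → killCol s x b c ≡ x b c
  killCol-old {s} x b c h with κ c ≟S s
  ... | yes e = ⊥-elim (h e)
  ... | no _  = refl

  total-killRow : ∀ x A → (∀ b → ρ b ≡ r → rowSum x b ≤ A) → total x ≤ total (killRow r x) + A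
  total-killRow {r} x A h with any? (λ b → ρ b ≟R r)
  ... | yes (b , refl) = ℕ.≤-trans
          (sum-drop (rowSum x) (rowSum (killRow r x)) b
            (λ b′ b′≢b → sum-cong-≗ λ c → killRow-old x b′ c (b′≢b ∘ ρ-inj)))
          (ℕ.+-monoʳ-≤ _ (h b refl))
  ... | no none = ℕ.≤-trans (ℕ.≤-reflexive (sum-cong-≗ λ b → sum-cong-≗ λ c →
          sym (killRow-old x b c (λ e → none (b , e))))) (ℕ.m≤m+n _ A)

  total-killCol : ∀ x A → (∀ c → κ c ≡ s → colSum x c ≤ A) → total x ≤ total (killCol s x) + A
  total-killCol {s} x A h with any? (λ c → κ c ≟S s)
  ... | yes (c , refl) = subst₂ (λ u v → u ≤ v + A) (sym (total-cols x)) (sym (total-cols (killCol s x))) (ℕ.≤-trans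
          (sum-drop (colSum x) (colSum (killCol s x)) c
            (λ c′ c′≢c → sum-cong-≗ λ b → killCol-old x b c′ (c′≢c ∘ κ-inj)))
          (ℕ.+-monoʳ-≤ _ (h c refl)))
  ... | no none = ℕ.≤-trans (ℕ.≤-reflexive (sum-cong-≗ λ b → sum-cong-≗ λ c →
          sym (killCol-old x b c (λ e → none (c , e))))) (ℕ.m≤m+n _ A)

  Covered : (Fin N → Set) → Table p q → Set
  Covered P x = ∀ b c → 0 < x b c → ∃ λ i → P i × row i ≡ ρ b × col i ≡ κ c

  module _ (α β : ℕ) (β≤α : β ≤ α) where

    Capped : Table p q → Set
    Capped x = (∀ b → rowSum x b ≤ α) × (∀ c → colSum x c ≤ β)

    Capped-≤ : {x y : Table p q} → (∀ b c → y b c ≤ x b c) → Capped x → Capped y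
    Capped-≤ h (r , c) = (λ b → ℕ.≤-trans (sum-mono (h b)) (r b)) ,
                         (λ c′ → ℕ.≤-trans (sum-mono λ b → h b c′) (c c′))

    -- If (b , c) is a leaf, the rows and columns that Matching-fill removes have weight at most α + β.
    loss-row : ∀ x b c s → Capped x → rowSum x b ≡ x b c ⊎ colSum x c ≡ x b c →
      total x ≤ total (killCol s (killCol (κ c) (killRow (ρ b) x))) + (α + β)
    loss-row x b c s cap@(rows , cols) (inj₂ leaf) = begin
      total x                    ≤⟨ total-killRow x α (λ b′ _ → rows b′) ⟩
      -- The leaf was the only entry of column c and went with row b, so this column costs 0.
      total x₁ + α               ≤⟨ ℕ.+-monoˡ-≤ α (total-killCol x₁ 0 λ c′ e → ℕ.≤-reflexive (empty c′ e)) ⟩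
      total x₂ + 0 + α           ≡⟨ cong (_+ α) (ℕ.+-identityʳ (total x₂)) ⟩
      total x₂ + α               ≤⟨ ℕ.+-monoˡ-≤ α (total-killCol x₂ β λ c′ _ → proj₂ cap₂ c′) ⟩
      total x₃ + β + α           ≡⟨ ℕ.+-assoc (total x₃) β α ⟩
      total x₃ + (β + α)         ≡⟨ cong (total x₃ +_) (ℕ.+-comm β α) ⟩
      total x₃ + (α + β)         ∎
      where
      open ℕ.≤-Reasoning
      x₁ = killRow (ρ b) x
      x₂ = killCol (κ c) x₁
      x₃ = killCol s x₂
      cap₂ : Capped x₂
      cap₂ = Capped-≤ (λ b c′ → ℕ.≤-trans (killCol-≤ (κ c) x₁ b c′) (killRow-≤ _ x b c′)) cap
      empty : ∀ c′ → κ c′ ≡ κ c → colSum x₁ c′ ≡ 0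
      empty c′ e rewrite κ-inj e = sum-zero λ b′ → ℕ.n≤0⇒n≡0 (ℕ.≮⇒≥ λ pos →
        ℕ.<-irrefl (sym (sum-rest (λ t → x t c) b leaf b′ (killRow-≢ x b′ c pos ∘ cong ρ)))
          (ℕ.<-≤-trans pos (killRow-≤ _ x b′ c)))
    loss-row x b c s cap@(rows , cols) (inj₁ leaf) = begin
      total x                    ≤⟨ total-killCol x β (λ c′ _ → cols c′) ⟩
      -- The leaf is the only entry of row b here, so the column goes first and leaves the row
      -- empty; the total cost is 2β.
      total x₁ + β               ≤⟨ ℕ.+-monoˡ-≤ β (total-killRow x₁ 0 λ b′ e → ℕ.≤-reflexive (empty b′ e)) ⟩
      total x₂ + 0 + β           ≡⟨ cong (_+ β) (ℕ.+-identityʳ (total x₂)) ⟩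
      total x₂ + β               ≤⟨ ℕ.+-monoˡ-≤ β (total-killCol x₂ β λ c′ _ → proj₂ cap₂ c′) ⟩
      total (killCol s x₂) + β + β ≡⟨ cong (λ t → t + β + β) (sum-cong-≗ λ b′ → sum-cong-≗ λ c′ → swap b′ c′) ⟩
      total x₃ + β + β           ≡⟨ ℕ.+-assoc (total x₃) β β ⟩
      total x₃ + (β + β)         ≤⟨ ℕ.+-monoʳ-≤ (total x₃) (ℕ.+-monoˡ-≤ β β≤α) ⟩
      total x₃ + (α + β)         ∎
      where
      open ℕ.≤-Reasoning
      x₁ = killCol (κ c) x
      x₂ = killRow (ρ b) x₁
      x₃ = killCol s (killCol (κ c) (killRow (ρ b) x))
      cap₂ : Capped x₂
      cap₂ = Capped-≤ (λ b′ c′ → ℕ.≤-trans (killRow-≤ (ρ b) x₁ b′ c′) (killCol-≤ _ x b′ c′)) cap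
      empty : ∀ b′ → ρ b′ ≡ ρ b → rowSum x₁ b′ ≡ 0
      empty b′ e rewrite ρ-inj e = sum-zero λ c′ → ℕ.n≤0⇒n≡0 (ℕ.≮⇒≥ λ pos →
        ℕ.<-irrefl (sym (sum-rest (x b) c leaf c′ (killCol-≢ x b c′ pos ∘ cong κ)))
          (ℕ.<-≤-trans pos (killCol-≤ _ x b c′)))
      swap : ∀ b′ c′ → killCol s x₂ b′ c′ ≡ x₃ b′ c′
      swap b′ c′ with ρ b′ ≟R ρ b | κ c′ ≟S κ c
      ... | yes _ | yes _ = refl
      ... | yes _ | no _  = refl
      ... | no _  | yes _ = refl
      ... | no _  | no _  = refl

    -- One column and one row are removed, as the row of `e` survives the second phase.
    loss-col : ∀ x c r → Capped x → total x ≤ total (killRow r (killCol (κ c) x)) + (α + β)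
    loss-col x c r cap = begin
      total x                    ≤⟨ total-killCol x β (λ c′ _ → proj₂ cap c′) ⟩
      total x₁ + β               ≤⟨ ℕ.+-monoˡ-≤ β (total-killRow x₁ α λ b′ _ → proj₁ cap₁ b′) ⟩
      total (killRow r x₁) + α + β ≡⟨ ℕ.+-assoc _ α β ⟩
      total (killRow r x₁) + (α + β) ∎
      where
      open ℕ.≤-Reasoning
      x₁ = killCol (κ c) x
      cap₁ : Capped x₁
      cap₁ = Capped-≤ (killCol-≤ (κ c) x) cap

    -- Induction on `k`: an exchange lowers `k` by one and the weight by at most α + β. For α + β >
    -- 0 the numerical hypothesis says that `k` is at most total / (α + β) rounded up, written
    -- without subtraction or division.
    weighted-fill : ∀ k (P : Fin N → Set) → (∀ i → Dec (P i)) → (x : Table p q) → Covered P x → Capped x →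
      k * (α + β) < total x + (α + β) → Fill (Matching P) k
    weighted-fill zero    P P? x cov cap lt = λ _ ()
    weighted-fill (suc k) P P? x₀ cov₀ cap₀ lt
      -- For `suc k` the hypothesis reads k (α + β) < total, so the weight is positive and a leaf
      -- can be produced. The new table is still covered by `P`, since its support lies in the old
      -- one.
      with with-leaf x₀ (ℕ.≤-<-trans z≤n (ℕ.+-cancelˡ-< (α + β) _ _ (subst ((suc k) * (α + β) <_) (ℕ.+-comm (total x₀) _) lt)))
    ... | x , same , b , c , pos , leaf with cov₀ b c (SameMargins.support same b c pos)
    ... | e , Pe , row-e , col-e = Matching-fill P e Pe byRow byCol P?
      where
      open SameMargins same
      γ = α + β

      cap : Capped x
      cap = (λ b → subst (_≤ α) (sym (rows b)) (proj₁ cap₀ b)) , (λ c → subst (_≤ β) (sym (cols c)) (proj₂ cap₀ c))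

      bound : ∀ y → total x ≤ total y + γ → k * γ < total y + γ
      bound y le = ℕ.<-≤-trans (ℕ.+-cancelˡ-< γ _ _ (subst (γ + k * γ <_) (trans (ℕ.+-comm (total x₀) γ)
        (cong (γ +_) (sym (SameMargins-total same)))) lt)) le

      byRow : ∀ f → P f → f ≢ e → row f ≡ row e →
        Fill (Matching λ i → P i × row i ≢ row e × col i ≢ col e × col i ≢ col f) k
      byRow f Pf f≢e row-f = weighted-fill k _
        (λ i → P? i ×-dec ¬? (row i ≟R row e) ×-dec ¬? (col i ≟S col e) ×-dec ¬? (col i ≟S col f))
        y cov (Capped-≤ y≤x cap) (bound y (loss-row x b c (col f) cap leaf))
        where
        x₁ = killRow (ρ b) x
        x₂ = killCol (κ c) x₁
        y  = killCol (col f) x₂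
        y≤x₁ : ∀ b c → y b c ≤ x₁ b c
        y≤x₁ b′ c′ = ℕ.≤-trans (killCol-≤ (col f) x₂ b′ c′) (killCol-≤ (κ c) x₁ b′ c′)
        y≤x : ∀ b c → y b c ≤ x b c
        y≤x b′ c′ = ℕ.≤-trans (y≤x₁ b′ c′) (killRow-≤ (ρ b) x b′ c′)
        cov : Covered _ y
        cov b′ c′ pos′ with cov₀ b′ c′ (support b′ c′ (ℕ.<-≤-trans pos′ (y≤x b′ c′)))
        ... | i , Pi , row-i , col-i = i ,
          (Pi , (λ eq → killRow-≢ x b′ c′ (ℕ.<-≤-trans pos′ (y≤x₁ b′ c′)) (trans (sym row-i) (trans eq row-e))) ,
                (λ eq → killCol-≢ x₁ b′ c′ (ℕ.<-≤-trans pos′ (killCol-≤ (col f) x₂ b′ c′)) (trans (sym col-i) (trans eq col-e))) ,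
                (λ eq → killCol-≢ x₂ b′ c′ pos′ (trans (sym col-i) eq))) , row-i , col-i

      byCol : ∀ f → P f → col f ≡ col e → row f ≢ row e →
        Fill (Matching λ i → P i × col i ≢ col e × row i ≢ row f) k
      byCol f Pf col-f row-f = weighted-fill k _
        (λ i → P? i ×-dec ¬? (col i ≟S col e) ×-dec ¬? (row i ≟R row f))
        y cov (Capped-≤ y≤x cap) (bound y (loss-col x c (row f) cap))
        where
        x₁ = killCol (κ c) x
        y  = killRow (row f) x₁
        y≤x : ∀ b c → y b c ≤ x b c
        y≤x b′ c′ = ℕ.≤-trans (killRow-≤ (row f) x₁ b′ c′) (killCol-≤ (κ c) x b′ c′)
        cov : Covered _ y
        cov b′ c′ pos′ with cov₀ b′ c′ (support b′ c′ (ℕ.<-≤-trans pos′ (y≤x b′ c′)))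
        ... | i , Pi , row-i , col-i = i ,
          (Pi , (λ eq → killCol-≢ x b′ c′ (ℕ.<-≤-trans pos′ (killRow-≤ (row f) x₁ b′ c′)) (trans (sym col-i) (trans eq col-e))) ,
                (λ eq → killRow-≢ x₁ b′ c′ pos′ (trans (sym row-i) eq))) , row-i , col-i

-- Dummy edges

Fill-≤ : ∀ {n j k} {X : Complex n} → j ≤ k → Fill X k → Fill X j
Fill-≤ j≤k fill s s<j = fill s (ℕ.<-≤-trans s<j j≤k)

χ : ∀ {n} → Face n → Fin n → ℕ
χ K a = if lookup K a then 1 else 0

χ-≤1 : ∀ {n} (K : Face n) a → χ K a ≤ 1
χ-≤1 K a with lookup K a
... | true  = ℕ.≤-refl
... | false = z≤n

sum-χ : ∀ {n} (K : Face n) p → sum (λ a → χ K a * p) ≡ size K * p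
sum-χ []          p = refl
sum-χ (true  ∷ K) p = cong₂ _+_ (ℕ.*-identityˡ p) (sum-χ K p)
sum-χ (false ∷ K) p = sum-χ K p

sum-* : ∀ {n} m (f : Fin n → ℕ) → sum (λ i → m * f i) ≡ m * sum f
sum-* {zero}  m f = sym (ℕ.*-zeroʳ m)
sum-* {suc n} m f = trans (cong (m * f zero +_) (sum-* m (f ∘ suc))) (sym (ℕ.*-distribˡ-+ m (f zero) _))

Selection : ∀ {n} → (Fin n → Set) → ℕ → Set
Selection {n} L k = Σ (Fin k → Fin n) λ σ → Injective _≡_ _≡_ σ × ∀ t → L (σ t)

-- An index of `Fin d` marks at most one element. Each marked element uses up its index, which
-- `punchIn` then removes, so at most `d` elements are discarded.
select : ∀ n d (L : Fin n → Set) (D : Fin n → Fin d → Set) → (∀ i → L i ⊎ ∃ (D i)) →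
  (∀ i j s → D i s → D j s → i ≡ j) → Selection L (n ∸ d)
select zero d L D h inj rewrite ℕ.0∸n≡0 d = (λ ()) , (λ { {()} }) , λ ()
select (suc n) d L D h inj with h zero
select (suc n) (suc d) L D h inj | inj₂ (s , Ds)
  with select n d (L ∘ suc) (λ i s′ → D (suc i) (punchIn s s′)) h′ (λ i j s′ e e′ → Fin.suc-injective (inj _ _ _ e e′))
  where
  h′ : ∀ i → L (suc i) ⊎ ∃ λ s′ → D (suc i) (punchIn s s′)
  h′ i with h (suc i)
  ... | inj₁ l = inj₁ l
  ... | inj₂ (s′ , Ds′) = inj₂ (punchOut s≢s′ , subst (D (suc i)) (sym (Fin.punchIn-punchOut s≢s′)) Ds′)
    where
    s≢s′ : s ≢ s′
    s≢s′ refl = Fin.0≢1+n (inj zero (suc i) s Ds Ds′)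
... | σ , σ-inj , left = suc ∘ σ , σ-inj ∘ Fin.suc-injective , left
select (suc n) d L D h inj | inj₁ l with d ℕ.≤? n
... | no d≰n rewrite ℕ.m≤n⇒m∸n≡0 (ℕ.≰⇒> d≰n) = (λ ()) , (λ { {()} }) , λ ()
... | yes d≤n with select n d (L ∘ suc) (D ∘ suc) (h ∘ suc) (λ i j s e e′ → Fin.suc-injective (inj _ _ s e e′))
... | σ , σ-inj , left = subst (Selection L) (sym (ℕ.+-∸-assoc 1 d≤n)) (σ′ , σ′-inj , left′)
  where
  σ′ : Fin (suc (n ∸ d)) → Fin (suc n)
  σ′ zero    = zero
  σ′ (suc t) = suc (σ t)
  σ′-inj : Injective _≡_ _≡_ σ′
  σ′-inj {zero}  {zero}  _ = refl
  σ′-inj {suc _} {suc _} e = cong suc (σ-inj (Fin.suc-injective e))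
  left′ : ∀ t → L (σ′ t)
  left′ zero    = l
  left′ (suc t) = left t

-- The edges of H, coloured by their first vertex, together with d dummy edges of each colour;
-- the dummy edges with the same index share a private row and column.  A rainbow matching of the
-- enlarged system uses at most d dummies.
module Deficiency (n m d : ℕ) (H : Hyp3 n n m) where

  #edges : ℕ
  #edges = n * (n * m + d)

  Cell : Set
  Cell = (Fin n × Fin m) ⊎ Fin d

  toCell : Fin (n * m + d) → Cell
  toCell = Sum.map₁ (remQuot m) ∘ splitAt (n * m)

  decode : Fin #edges → Fin n × Cell
  decode = Product.map₂ toCell ∘ remQuot (n * m + d)

  encode : Fin n → Cell → Fin #edges
  encode a (inj₁ (b , c)) = combine a (combine b c ↑ˡ d)
  encode a (inj₂ s)       = combine a ((n * m) ↑ʳ s)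

  decode-encode : ∀ a t → decode (encode a t) ≡ (a , t)
  decode-encode a (inj₁ (b , c)) = trans (cong (Product.map₂ toCell) (remQuot-combine a (combine b c ↑ˡ d)))
    (cong (a ,_) (trans (cong (Sum.map₁ (remQuot m)) (splitAt-↑ˡ (n * m) (combine b c) d))
      (cong inj₁ (remQuot-combine b c))))
  decode-encode a (inj₂ s) = trans (cong (Product.map₂ toCell) (remQuot-combine a ((n * m) ↑ʳ s)))
    (cong (λ t → a , Sum.map₁ (remQuot m) t) (splitAt-↑ʳ (n * m) d s))

  colour : Fin #edges → Fin n
  colour i = proj₁ (decode i)

  cell : Fin #edges → Cell
  cell i = proj₂ (decode i)

  row : Fin #edges → Fin n ⊎ Fin d
  row i = Sum.map₁ proj₁ (cell i)

  col : Fin #edges → Fin m ⊎ Fin d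
  col i = Sum.map₁ proj₂ (cell i)

  open LineGraph (≡-dec Fin._≟_ Fin._≟_) (≡-dec Fin._≟_ Fin._≟_) row col
  open WeightedFill (≡-dec Fin._≟_ Fin._≟_) (≡-dec Fin._≟_ Fin._≟_) row col inj₁ inj₁-injective inj₁ inj₁-injective

  -- The bound `t` admits dummies one index at a time, for the induction in `dummy-fill`.
  Alive : ℕ → Fin n → Cell → Set
  Alive t a (inj₁ (b , c)) = H a b c ≡ true
  Alive t a (inj₂ s)       = toℕ s < t

  Edge : ℕ → Face n → Fin #edges → Set
  Edge t K i = colour i ∈ K × Alive t (colour i) (cell i)

  Edge? : ∀ t K i → Dec (Edge t K i)
  Edge? t K i = (lookup K (colour i) Bool.≟ true) ×-dec alive? (colour i) (cell i)
    where
    alive? : ∀ a u → Dec (Alive t a u)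
    alive? a (inj₁ (b , c)) = H a b c Bool.≟ true
    alive? a (inj₂ s)       = toℕ s ℕ.<? t

  Edge-encode : ∀ {t} K a u → a ∈ K → Alive t a u → Edge t K (encode a u)
  Edge-encode {t} K a u a∈ al =
    subst (λ (a′ , u′) → a′ ∈ K × Alive t a′ u′) (sym (decode-encode a u)) (a∈ , al)

  Matching-mono : {P Q : Fin #edges → Set} → (∀ i → P i → Q i) → ∀ F → Matching P F → Matching Q F
  Matching-mono h F (p , q) = (λ i i∈ → h i (p i i∈)) , q

  map₁-inj₂ : ∀ {A B C : Set} {h : A → B} (u : A ⊎ C) {s} → Sum.map₁ h u ≡ inj₂ s → u ≡ inj₂ s
  map₁-inj₂ (inj₂ s) refl = refl

  -- The dummies with one index conflict with each other and with no other edge, so admitting them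
  -- joins the complex with a discrete set and raises its connectivity by one. The colour `a` of `K`
  -- makes this set nonempty.
  dummy-fill : ∀ K a → a ∈ K → ∀ k t → t ≤ d → Fill (Matching (Edge 0 K)) k → Fill (Matching (Edge t K)) (t + k)
  dummy-fill K a a∈ k zero    _   h = h
  dummy-fill K a a∈ k (suc t) t<d h = Matching-fill (Edge (suc t) K) e
    (Edge-encode K a (inj₂ s) a∈ (subst (_< suc t) (sym (toℕ-fromℕ< t<d)) (ℕ.n<1+n t)))
    (λ f _ _ row-f → Fill-cong (Matching-mono (λ i → to f row-f i)) (Matching-mono (λ i → from i))
       (dummy-fill K a a∈ k t (ℕ.<⇒≤ t<d) h))
    -- An edge in the column of a dummy is a dummy with the same index, hence also in its row.
    (λ f _ col-f row-f → ⊥-elim (row-f (trans (cong (Sum.map₁ proj₁) (map₁-inj₂ (cell f) (trans col-f col-e))) (sym row-e))))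
    (Edge? (suc t) K)
    where
    s : Fin d
    s = fromℕ< t<d
    e : Fin #edges
    e = encode a (inj₂ s)
    row-e : row e ≡ inj₂ s
    row-e = cong (Sum.map₁ proj₁ ∘ proj₂) (decode-encode a (inj₂ s))
    col-e : col e ≡ inj₂ s
    col-e = cong (Sum.map₁ proj₂ ∘ proj₂) (decode-encode a (inj₂ s))

    not-s : ∀ i → Edge t K i → cell i ≢ inj₂ s
    not-s i (_ , al) eq = ℕ.<-irrefl (toℕ-fromℕ< t<d) (subst (Alive t (colour i)) eq al)

    grow : ∀ a u → Alive t a u → Alive (suc t) a u
    grow a (inj₁ _) al = al
    grow a (inj₂ _) al = ℕ.m<n⇒m<1+n al

    shrink : ∀ a u → u ≢ inj₂ s → Alive (suc t) a u → Alive t a u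
    shrink a (inj₁ _) _   al = al
    shrink a (inj₂ s′) ≢s al with ℕ.m<1+n⇒m<n∨m≡n al
    ... | inj₁ lt = lt
    ... | inj₂ eq = ⊥-elim (≢s (cong inj₂ (toℕ-injective (trans eq (sym (toℕ-fromℕ< t<d))))))

    to : ∀ f → row f ≡ row e → ∀ i → Edge t K i → Edge (suc t) K i × row i ≢ row e × col i ≢ col e × col i ≢ col f
    to f row-f i E@(c∈ , al) = (c∈ , grow _ (cell i) al) ,
      (λ eq → not-s i E (map₁-inj₂ (cell i) (trans eq row-e))) ,
      (λ eq → not-s i E (map₁-inj₂ (cell i) (trans eq col-e))) ,
      (λ eq → not-s i E (map₁-inj₂ (cell i) (trans eq (cong (Sum.map₁ proj₂) (map₁-inj₂ (cell f) (trans row-f row-e))))))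

    from : ∀ i {A : Set} → Edge (suc t) K i × row i ≢ row e × A → Edge t K i
    from i ((c∈ , al) , ≢e , _) = c∈ , shrink _ (cell i) (λ eq → ≢e (trans (cong (Sum.map₁ proj₁) eq) (sym row-e))) al

  module _ (g : Fin n → Fin n → Fin m → ℕ) (g⊆H : ∀ a b c → 0 < g a b c → H a b c ≡ true)
    (α β : ℕ) (β≤α : β ≤ α) (α>0 : 0 < α)
    (deg-a : ∀ a → total (g a) ≡ α)
    (deg-b : ∀ b → total (λ a c → g a b c) ≤ α)
    (deg-c : ∀ c → total (λ a b → g a b c) ≤ β)
    (enough : n * β < suc d * (α + β)) where

    link : Face n → Table n m
    link K b c = sum λ a → χ K a * g a b c

    link-total : ∀ K → total (link K) ≡ size K * α
    link-total K = begin
      sum (λ b → sum (λ c → sum (λ a → χ K a * g a b c)))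
        ≡⟨ sum-cong-≗ (λ b → ∑-comm (λ c a → χ K a * g a b c)) ⟩
      sum (λ b → sum (λ a → sum (λ c → χ K a * g a b c)))
        ≡⟨ ∑-comm (λ b a → sum (λ c → χ K a * g a b c)) ⟩
      sum (λ a → sum (λ b → sum (λ c → χ K a * g a b c)))
        ≡⟨ sum-cong-≗ (λ a → trans (sum-cong-≗ λ b → sum-* (χ K a) (g a b)) (sum-* (χ K a) (rowSum (g a)))) ⟩
      sum (λ a → χ K a * total (g a))
        ≡⟨ sum-cong-≗ (λ a → cong (χ K a *_) (deg-a a)) ⟩
      sum (λ a → χ K a * α)
        ≡⟨ sum-χ K α ⟩
      size K * α ∎
      where open ≡-Reasoning

    link-≤ : ∀ K b c → link K b c ≤ sum (λ a → g a b c)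
    link-≤ K b c = sum-mono λ a → ℕ.≤-trans (ℕ.*-monoˡ-≤ (g a b c) (χ-≤1 K a)) (ℕ.≤-reflexive (ℕ.*-identityˡ _))

    link-capped : ∀ K → Capped α β β≤α (link K)
    link-capped K =
      (λ b → ℕ.≤-trans (sum-mono (link-≤ K b)) (ℕ.≤-trans (ℕ.≤-reflexive (∑-comm (λ c a → g a b c))) (deg-b b))) ,
      (λ c → ℕ.≤-trans (sum-mono λ b → link-≤ K b c) (ℕ.≤-trans (ℕ.≤-reflexive (∑-comm (λ b a → g a b c))) (deg-c c)))

    link-covered : ∀ K → Covered (Edge 0 K) (link K)
    link-covered K b c pos with sum-positive (λ a → χ K a * g a b c) pos
    ... | a , lt with lookup K a in eq
    ... | true = encode a u , Edge-encode K a u eq (g⊆H a b c (subst (0 <_) (ℕ.*-identityˡ _) lt)) ,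
                 cong (Sum.map₁ proj₁ ∘ proj₂) (decode-encode a u) , cong (Sum.map₁ proj₂ ∘ proj₂) (decode-encode a u)
      where
      u : Cell
      u = inj₁ (b , c)

    -- For σ ≥ d the claim rearranges to σ β < (d + 1)(α + β), whose worst case σ = n is `enough`.
    size-bound : ∀ σ → σ ≤ n → (σ ∸ d) * (α + β) < σ * α + (α + β)
    size-bound σ σ≤n with ℕ.≤-total σ d
    ... | inj₁ σ≤d rewrite ℕ.m≤n⇒m∸n≡0 σ≤d = ℕ.<-≤-trans α>0 (ℕ.≤-trans (ℕ.m≤m+n α β) (ℕ.m≤n+m _ (σ * α)))
    ... | inj₂ d≤σ with ℕ.m≤n⇒∃[o]m+o≡n d≤σ
    ... | k , refl rewrite ℕ.m+n∸m≡n d k = ℕ.+-cancelʳ-< (d * β) _ _ (begin-strict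
      k * (α + β) + d * β             ≡⟨ solve 4 (λ k d α β → k :* (α :+ β) :+ d :* β := k :* α :+ (d :+ k) :* β) refl k d α β ⟩
      k * α + (d + k) * β             ≤⟨ ℕ.+-monoʳ-≤ (k * α) (ℕ.*-monoˡ-≤ β σ≤n) ⟩
      k * α + n * β                   <⟨ ℕ.+-monoʳ-< (k * α) enough ⟩
      k * α + suc d * (α + β)         ≡⟨ solve 4 (λ k d α β → k :* α :+ (con 1 :+ d) :* (α :+ β) := (d :+ k) :* α :+ (α :+ β) :+ d :* β) refl k d α β ⟩
      (d + k) * α + (α + β) + d * β   ∎)
      where
      open ℕ.≤-Reasoning
      open +-*-Solver

    fill : ∀ K → Fill (Matching (Edge d K)) (size K)
    fill K with size K in sz
    -- The empty set has no colour to carry a dummy, but there is nothing to fill either.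
    ... | zero  = λ _ ()
    ... | suc σ with size-suc K sz
    ... | a , a∈ = Fill-≤ (ℕ.m≤n+m∸n (suc σ) d) (dummy-fill K a a∈ (suc σ ∸ d) d ℕ.≤-refl
      (weighted-fill α β β≤α (suc σ ∸ d) (Edge 0 K) (Edge? 0 K) (link K) (link-covered K) (link-capped K)
        (subst (λ t → (suc σ ∸ d) * (α + β) < t + (α + β)) (sym (trans (link-total K) (cong (_* α) sz)))
          (size-bound (suc σ) (subst (_≤ n) sz (size-≤ K))))))

    open Rainbow colour (λ K → Matching (Edge d K)) fill
      (λ K j F → Matching-mono (λ i (c∈ , al) → proj₂ (∈-delete⁻ {F = K} c∈) , al) F)
      (λ K → (λ i i∈ → ⊥-elim (∈⇒¬∉ {F = replicate #edges false} i∈ (lookup-replicate i false))) ,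
             (λ i j i∈ → ⊥-elim (∈⇒¬∉ {F = replicate #edges false} i∈ (lookup-replicate i false))))
      (λ K F (p , _) u u∈ → proj₁ (p u u∈))

    hasMatching : HasMatching H (n ∸ d)
    hasMatching with rainbow (replicate n true)
    ... | F , (alive , disjoint) , hit = result
      where
      v : Fin n → Fin #edges
      v a = proj₁ (hit a (lookup-replicate a true))
      v∈ : ∀ a → v a ∈ F
      v∈ a = proj₁ (proj₂ (hit a (lookup-replicate a true)))
      colour-v : ∀ a → colour (v a) ≡ a
      colour-v a = proj₂ (proj₂ (hit a (lookup-replicate a true)))
      v-meet : ∀ a a′ → Meet (v a) (v a′) → a ≡ a′
      v-meet a a′ meet with v a Fin.≟ v a′
      ... | yes eq = trans (sym (colour-v a)) (trans (cong colour eq) (colour-v a′))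
      ... | no neq = ⊥-elim (disjoint _ _ (v∈ a) (v∈ a′) neq meet)

      Real : Fin n → Set
      Real a = ∃₂ λ b c → cell (v a) ≡ inj₁ (b , c)

      classify : ∀ a → Real a ⊎ ∃ λ s → cell (v a) ≡ inj₂ s
      classify a with cell (v a)
      ... | inj₁ (b , c) = inj₁ (b , c , refl)
      ... | inj₂ s       = inj₂ (s , refl)

      selection : Selection Real (n ∸ d)
      selection = select n d Real (λ a s → cell (v a) ≡ inj₂ s) classify
        (λ a a′ s e e′ → v-meet a a′ (inj₁ (cong (Sum.map₁ proj₁) (trans e (sym e′)))))

      result : HasMatching H (n ∸ d)
      result with selection
      ... | σ , σ-inj , real = σ , (λ t → proj₁ (real t)) , (λ t → proj₁ (proj₂ (real t))) , σ-inj ,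
        (λ {t} {t′} e → σ-inj (v-meet _ _ (inj₁ (trans (cong (Sum.map₁ proj₁) (proj₂ (proj₂ (real t))))
           (trans (cong inj₁ e) (sym (cong (Sum.map₁ proj₁) (proj₂ (proj₂ (real t′)))))))))) ,
        (λ {t} {t′} e → σ-inj (v-meet _ _ (inj₂ (trans (cong (Sum.map₁ proj₂) (proj₂ (proj₂ (real t))))
           (trans (cong inj₁ e) (sym (cong (Sum.map₁ proj₂) (proj₂ (proj₂ (real t′)))))))))) ,
        edge
        where
        edge : ∀ t → H (σ t) (proj₁ (real t)) (proj₁ (proj₂ (real t))) ≡ true
        edge t = subst₂ (Alive d) (colour-v (σ t)) (proj₂ (proj₂ (real t))) (proj₂ (alive _ (v∈ (σ t))))

-- Clearing denominators

-- q = g / (1 + D).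
Rep : ℕ → ℚ → ℕ → Set
Rep D q g = toℚᵘ q ≃ mkℚᵘ (posℤ g) D

Rep-0 : ∀ D → Rep D 0ℚ 0
Rep-0 D = *≡* refl

Rep-injective : ∀ {D q g g′} → Rep D q g → Rep D q g′ → g ≡ g′
Rep-injective {D} {q} {g} {g′} r r′ with ℚᵘ.≃-trans {mkℚᵘ (posℤ g) D} {toℚᵘ q} {mkℚᵘ (posℤ g′) D} (ℚᵘ.≃-sym r) r′
... | *≡* eq = ℤ.+-injective (ℤ.*-cancelʳ-≡ (posℤ g) (posℤ g′) (posℤ (suc D)) eq)

Rep-zero : ∀ {D q} → Rep D q 0 → q ≡ 0ℚ
Rep-zero {D} {q} r = ℚ.toℚᵘ-injective (ℚᵘ.≃-trans r (ℚᵘ.≃-sym (Rep-0 D)))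

Rep-+ : ∀ {D q q′ g g′} → Rep D q g → Rep D q′ g′ → Rep D (q ℚ.+ q′) (g + g′)
Rep-+ {D} {q} {q′} {g} {g′} r r′ = ℚᵘ.≃-trans (ℚ.toℚᵘ-homo-+ q q′) (ℚᵘ.≃-trans (ℚᵘ.+-cong r r′) (*≡* (begin
  (posℤ g ℤ.* d ℤ.+ posℤ g′ ℤ.* d) ℤ.* d   ≡⟨ cong (ℤ._* d) (ℤ.*-distribʳ-+ d (posℤ g) (posℤ g′)) ⟨
  ((posℤ g ℤ.+ posℤ g′) ℤ.* d) ℤ.* d       ≡⟨ ℤ.*-assoc (posℤ g ℤ.+ posℤ g′) d d ⟩
  (posℤ g ℤ.+ posℤ g′) ℤ.* (d ℤ.* d)       ≡⟨ cong₂ ℤ._*_ (ℤ.pos-+ g g′) (ℤ.pos-* (suc D) (suc D)) ⟨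
  posℤ (g + g′) ℤ.* posℤ (suc D * suc D)   ∎)))
  where
  open ≡-Reasoning
  d = posℤ (suc D)

Rep-sum : ∀ {D} n {f : Fin n → ℚ} {g : Fin n → ℕ} → (∀ i → Rep D (f i) (g i)) → Rep D (Σℚ n f) (sum g)
Rep-sum {D} zero  h = Rep-0 D
Rep-sum (suc n) {f} {g} h = Rep-+ {q = f zero} {Σℚ n (f ∘ suc)} (h zero) (Rep-sum n (h ∘ suc))

-- Denominators are stored as predecessors, and `D + E * suc D` is the predecessor of
-- `suc E * suc D`.
Rep-scale : ∀ {D q g} E → Rep D q g → Rep (D + E * suc D) q (suc E * g)
Rep-scale {D} {q} {g} E r = ℚᵘ.≃-trans r (*≡* (begin
  posℤ g ℤ.* posℤ (suc E * suc D)          ≡⟨ ℤ.pos-* g (suc E * suc D) ⟨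
  posℤ (g * (suc E * suc D))            ≡⟨ cong posℤ (ℕ.*-assoc g (suc E) (suc D)) ⟨
  posℤ (g * suc E * suc D)              ≡⟨ cong (λ t → posℤ (t * suc D)) (ℕ.*-comm g (suc E)) ⟩
  posℤ (suc E * g * suc D)              ≡⟨ ℤ.pos-* (suc E * g) (suc D) ⟩
  posℤ (suc E * g) ℤ.* posℤ (suc D)          ∎))
  where open ≡-Reasoning

Rep-exists : ∀ q → 0ℚ ℚ.≤ q → ∃ λ D → ∃ λ g → Rep D q g
Rep-exists (mkℚ (posℤ g) D c) _ = D , g , ℚᵘ.≃-refl
Rep-exists (mkℚ -[1+ g ] D c) (ℚ.*≤* ())

-- Stated for any property that passes to multiples of a denominator, so that it can be nested over
-- the three sides.
common-denominator : ∀ {n} (Q : Fin n → ℕ → Set) → (∀ i D E → Q i D → Q i (D + E * suc D)) →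
  (∀ i → ∃ (Q i)) → ∃ λ D → ∀ i → Q i D
common-denominator {zero}  Q scale h = 0 , λ ()
common-denominator {suc n} Q scale h with h zero | common-denominator (Q ∘ suc) (scale ∘ suc) (h ∘ suc)
... | D , q | D′ , q′ = D + D′ * suc D , λ
  { zero    → scale zero D D′ q
  ; (suc i) → subst (Q (suc i)) (ℕ.suc-injective (ℕ.*-comm (suc D) (suc D′))) (scale (suc i) D′ D (q′ i)) }

common-denominator₃ : ∀ {a b c} (f : Weight a b c) → (∀ i j k → 0ℚ ℚ.≤ f i j k) →
  ∃ λ D → ∀ i j k → ∃ (Rep D (f i j k))
common-denominator₃ f f≥0 =
  common-denominator _ (λ i D E h j k → scale i j k D E (h j k)) λ i →
  common-denominator _ (λ j D E h k → scale i j k D E (h k)) λ j →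
  common-denominator _ (scale i j) λ k → Rep-exists (f i j k) (f≥0 i j k)
  where
  scale : ∀ i j k D E → ∃ (Rep D (f i j k)) → ∃ (Rep (D + E * suc D) (f i j k))
  scale i j k D E (g , r) = suc E * g , Rep-scale {q = f i j k} E r

-- Matchings in balanced hypergraphs

sum-const : ∀ n k → sum {n} (λ _ → k) ≡ n * k
sum-const zero    k = refl
sum-const (suc n) k = cong (k +_) (sum-const n k)

record BalancedWeight {n m : ℕ} (H : Hyp3 n n m) : Set where
  field
    g     : Fin n → Fin n → Fin m → ℕ
    g⊆H   : ∀ a b c → 0 < g a b c → H a b c ≡ true
    α β   : ℕ
    α>0   : 0 < α
    deg-a : ∀ a → total (g a) ≡ α
    deg-b : ∀ b → total (λ a c → g a b c) ≡ α
    deg-c : ∀ c → total (λ a b → g a b c) ≡ β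
    m*β   : m * β ≡ n * α

-- The total weight is counted from each side: the two sides of size `n` must have the same degree
-- α, and comparison with the third gives `m * β ≡ n * α`.
clear-denominators : ∀ {n m} (H : Hyp3 n n m) → FracBalanced H → BalancedWeight H
clear-denominators {n} {m} H (f , (f≥0 , f⊆H) , (bal₁ , bal₂ , bal₃) , a₀ , b₀ , c₀ , f≢0) = record
  { g = g ; g⊆H = g⊆H ; α = deg₁ᴺ a₀ ; β = deg₃ᴺ c₀
  ; α>0 = ℕ.<-≤-trans g>0 (ℕ.≤-trans (term≤sum (g a₀ b₀) c₀) (term≤sum (rowSum (g a₀)) b₀))
  ; deg-a = deg-a ; deg-b = deg-b ; deg-c = deg-c
  ; m*β = trans (sym total₃) total₁
  }
  where
  common = common-denominator₃ f f≥0
  D = proj₁ common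
  g : Fin n → Fin n → Fin m → ℕ
  g a b c = proj₁ (proj₂ common a b c)
  rep : ∀ a b c → Rep D (f a b c) (g a b c)
  rep a b c = proj₂ (proj₂ common a b c)

  deg₁ᴺ deg₂ᴺ : Fin n → ℕ
  deg₁ᴺ a = total (g a)
  deg₂ᴺ b = total (λ a c → g a b c)
  deg₃ᴺ : Fin m → ℕ
  deg₃ᴺ c = total (λ a b → g a b c)

  rep₁ : ∀ a → Rep D (deg₁ f a) (deg₁ᴺ a)
  rep₁ a = Rep-sum n λ b → Rep-sum m λ c → rep a b c
  rep₂ : ∀ b → Rep D (deg₂ f b) (deg₂ᴺ b)
  rep₂ b = Rep-sum n λ a → Rep-sum m λ c → rep a b c
  rep₃ : ∀ c → Rep D (deg₃ f c) (deg₃ᴺ c)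
  rep₃ c = Rep-sum n λ a → Rep-sum n λ b → rep a b c

  deg-a : ∀ a → deg₁ᴺ a ≡ deg₁ᴺ a₀
  deg-a a = Rep-injective {q = deg₁ f a₀} (subst (λ q → Rep D q (deg₁ᴺ a)) (bal₁ a a₀) (rep₁ a)) (rep₁ a₀)
  deg-b′ : ∀ b → deg₂ᴺ b ≡ deg₂ᴺ b₀
  deg-b′ b = Rep-injective {q = deg₂ f b₀} (subst (λ q → Rep D q (deg₂ᴺ b)) (bal₂ b b₀) (rep₂ b)) (rep₂ b₀)
  deg-c : ∀ c → deg₃ᴺ c ≡ deg₃ᴺ c₀
  deg-c c = Rep-injective {q = deg₃ f c₀} (subst (λ q → Rep D q (deg₃ᴺ c)) (bal₃ c c₀) (rep₃ c)) (rep₃ c₀)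

  total₁ : sum deg₁ᴺ ≡ n * deg₁ᴺ a₀
  total₁ = trans (sum-cong-≗ deg-a) (sum-const n _)
  total₂ : sum deg₁ᴺ ≡ n * deg₂ᴺ b₀
  total₂ = trans (∑-comm (λ a b → sum (g a b))) (trans (sum-cong-≗ deg-b′) (sum-const n _))
  total₃ : sum deg₁ᴺ ≡ m * deg₃ᴺ c₀
  total₃ = trans (sum-cong-≗ λ a → ∑-comm (g a))
    (trans (∑-comm (λ a c → sum λ b → g a b c)) (trans (sum-cong-≗ deg-c) (sum-const m _)))

  instance
    n≢0 : NonZero n
    n≢0 = nonZero a₀
      where
      nonZero : ∀ {k} → Fin k → NonZero k
      nonZero {suc k} _ = _

  deg-b : ∀ b → deg₂ᴺ b ≡ deg₁ᴺ a₀
  deg-b b = trans (deg-b′ b) (ℕ.*-cancelˡ-≡ _ _ n (trans (sym total₂) total₁))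

  g>0 : 0 < g a₀ b₀ c₀
  g>0 = ℕ.n≢0⇒n>0 λ e → f≢0 (Rep-zero (subst (Rep D (f a₀ b₀ c₀)) e (rep a₀ b₀ c₀)))

  g⊆H : ∀ a b c → 0 < g a b c → H a b c ≡ true
  g⊆H a b c pos with H a b c in eq
  ... | true  = refl
  ... | false = ⊥-elim (ℕ.<-irrefl
    (Rep-injective {q = 0ℚ} (Rep-0 D) (subst (λ q → Rep D q (g a b c)) (f⊆H a b c eq) (rep a b c))) pos)

-- With r = m / n this says (n, n, rn) → ⌈rn / (r + 1)⌉, from which both parts follow.
BM-suc : ∀ n m t → n ≤ m → .{{NonZero n}} → t * (m + n) < n * m → BM n n m (suc t)
BM-suc n m t n≤m t-small H fb = subst (HasMatching H) (ℕ.m∸[m∸n]≡n t<n)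
  (Deficiency.hasMatching n m d H g g⊆H α β β≤α α>0 deg-a (ℕ.≤-reflexive ∘ deg-b) (ℕ.≤-reflexive ∘ deg-c) enough)
  where
  open BalancedWeight (clear-denominators H fb)
  open ℕ.≤-Reasoning
  open +-*-Solver
  -- The deficiency for which `n ∸ d` is the desired `suc t`.
  d = n ∸ suc t

  instance
    m≢0 : NonZero m
    m≢0 = >-nonZero (ℕ.<-≤-trans (>-nonZero⁻¹ n) n≤m)
    α≢0 : NonZero α
    α≢0 = >-nonZero α>0

  t<n : t < n
  t<n = ℕ.≰⇒> λ n≤t → ℕ.<⇒≱ t-small (ℕ.*-mono-≤ n≤t (ℕ.m≤m+n m n))

  β≤α : β ≤ α
  β≤α = ℕ.*-cancelˡ-≤ m (ℕ.≤-trans (ℕ.≤-reflexive m*β) (ℕ.*-monoˡ-≤ α n≤m))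

  n² : n * n < suc d * (m + n)
  n² = ℕ.+-cancelʳ-< (n * m) _ _ (begin-strict
    n * n + n * m                       ≡⟨ solve 2 (λ n m → n :* n :+ n :* m := n :* (m :+ n)) refl n m ⟩
    n * (m + n)                         ≡⟨ cong (_* (m + n)) (ℕ.m∸n+n≡m t<n) ⟨
    (d + suc t) * (m + n)               ≡⟨ solve 3 (λ d t s → (d :+ (con 1 :+ t)) :* s := (con 1 :+ d) :* s :+ t :* s) refl d t (m + n) ⟩
    suc d * (m + n) + t * (m + n)       <⟨ ℕ.+-monoʳ-< (suc d * (m + n)) t-small ⟩
    suc d * (m + n) + n * m             ∎)

  -- Since α : β = m : n, this is `n²` rescaled; multiplying by `m` lets `m*β` replace β by α.
  enough : n * β < suc d * (α + β)
  enough = ℕ.*-cancelˡ-< m _ _ (begin-strict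
    m * (n * β)                         ≡⟨ solve 3 (λ m n β → m :* (n :* β) := n :* (m :* β)) refl m n β ⟩
    n * (m * β)                         ≡⟨ cong (n *_) m*β ⟩
    n * (n * α)                         ≡⟨ ℕ.*-assoc n n α ⟨
    n * n * α                           <⟨ ℕ.*-monoˡ-< α n² ⟩
    suc d * (m + n) * α                 ≡⟨ solve 4 (λ d m n α → (con 1 :+ d) :* (m :+ n) :* α := (con 1 :+ d) :* (m :* α :+ n :* α)) refl d m n α ⟩
    suc d * (m * α + n * α)             ≡⟨ cong (λ t → suc d * (m * α + t)) m*β ⟨
    suc d * (m * α + m * β)             ≡⟨ solve 4 (λ d m α β → (con 1 :+ d) :* (m :* α :+ m :* β) := m :* ((con 1 :+ d) :* (α :+ β))) refl d m α β ⟩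
    m * (suc d * (α + β))               ∎)

-- Comparison of the two ceilings

BM-zero : ∀ {a b c} → BM a b c 0
BM-zero H fb = (λ ()) , (λ ()) , (λ ()) , (λ { {()} }) , (λ { {()} }) , (λ { {()} }) , λ ()

⌈/⌉-< : ∀ x y .{{_ : NonZero y}} t → ⌈ x / y ⌉ ≡ suc t → t * y < x
⌈/⌉-< x y@(suc y-1) t eq = ℕ.+-cancelˡ-≤ y-1 _ _ (begin
  y-1 + suc (t * y)        ≡⟨ ℕ.+-suc y-1 (t * y) ⟩
  suc t * y                ≡⟨ cong (_* y) eq ⟨
  (x + y ∸ 1) / y * y      ≤⟨ m/n*n≤m (x + y ∸ 1) y ⟩
  x + y ∸ 1                ≡⟨ cong (_∸ 1) (ℕ.+-suc x y-1) ⟩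
  x + y-1                  ≡⟨ ℕ.+-comm x y-1 ⟩
  y-1 + x                  ∎)
  where open ℕ.≤-Reasoning

≤-⌈/⌉* : ∀ x y .{{_ : NonZero y}} → x ≤ ⌈ x / y ⌉ * y
≤-⌈/⌉* x y@(suc y-1) = ℕ.+-cancelˡ-≤ y-1 _ _ (begin
  y-1 + x                                  ≡⟨ ℕ.+-comm y-1 x ⟩
  x + y-1                                  ≡⟨ cong (_∸ 1) (ℕ.+-suc x y-1) ⟨
  x + y ∸ 1                                ≡⟨ m≡m%n+[m/n]*n (x + y ∸ 1) y ⟩
  (x + y ∸ 1) % y + ⌈ x / y ⌉ * y          ≤⟨ ℕ.+-monoˡ-≤ _ (ℕ.≤-pred (m%n<n (x + y ∸ 1) y)) ⟩
  y-1 + ⌈ x / y ⌉ * y                      ∎)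
  where open ℕ.≤-Reasoning

-- If the ceiling is t + 1 then t < x / y, so it is enough that every natural number below x / y is
-- below mn / (m + n).
BM-⌈/⌉ : ∀ n m .{{_ : NonZero n}} x y .{{_ : NonZero y}} → n ≤ m →
  (∀ t → t * y < x → t * (m + n) < n * m) → BM n n m ⌈ x / y ⌉
BM-⌈/⌉ n m x y n≤m small with ⌈ x / y ⌉ in eq
... | zero  = BM-zero
... | suc t = BM-suc n m t n≤m (small t (⌈/⌉-< x y t eq))

theorem4p6 : (n m : ℕ) → .{{_ : NonZero n}} → n ≤ m →
    BM n n m ⌈ floor2r n m * n / 2 + floor2r n m ⌉
    × BM n n m ⌈ 2 * m / 2 + ceil2r n m ⌉
theorem4p6 n m n≤m = BM-⌈/⌉ n m (⌊2r⌋ * n) (2 + ⌊2r⌋) n≤m floor-case , BM-⌈/⌉ n m (2 * m) (2 + ⌈2r⌉) n≤m ceil-case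
  where
  open ℕ.≤-Reasoning
  open +-*-Solver
  ⌊2r⌋ = floor2r n m
  ⌈2r⌉ = ceil2r n m

  -- As a function of q, the quotient qn / (q + 2) is increasing and equals mn / (m + n) at q = 2m /
  -- n. Writing n = t + u turns the hypothesis into 2t < q u, where q occurs once and q n ≤ 2m can
  -- be applied.
  floor-case : ∀ t → t * (2 + ⌊2r⌋) < ⌊2r⌋ * n → t * (m + n) < n * m
  floor-case t lt with ℕ.m≤n⇒∃[o]m+o≡n t≤n
    where
    t≤n : t ≤ n
    t≤n = ℕ.<⇒≤ (ℕ.≰⇒> λ n≤t → ℕ.<⇒≱ lt (begin
      ⌊2r⌋ * n       ≡⟨ ℕ.*-comm ⌊2r⌋ n ⟩
      n * ⌊2r⌋       ≤⟨ ℕ.*-mono-≤ n≤t (ℕ.m≤n+m ⌊2r⌋ 2) ⟩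
      t * (2 + ⌊2r⌋) ∎))
  ... | u , t+u≡n = ℕ.*-cancelˡ-< 2 _ _ (begin-strict
    2 * (t * (m + n))           ≡⟨ solve 3 (λ t m n → con 2 :* (t :* (m :+ n)) := con 2 :* t :* n :+ con 2 :* m :* t) refl t m n ⟩
    2 * t * n + 2 * m * t       <⟨ ℕ.+-monoˡ-< (2 * m * t) (ℕ.*-monoˡ-< n 2t<qu) ⟩
    ⌊2r⌋ * u * n + 2 * m * t       ≡⟨ cong (_+ 2 * m * t) (solve 3 (λ q u n → q :* u :* n := q :* n :* u) refl ⌊2r⌋ u n) ⟩
    ⌊2r⌋ * n * u + 2 * m * t       ≤⟨ ℕ.+-monoˡ-≤ (2 * m * t) (ℕ.*-monoˡ-≤ u (m/n*n≤m (2 * m) n)) ⟩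
    2 * m * u + 2 * m * t       ≡⟨ solve 3 (λ m t u → con 2 :* m :* u :+ con 2 :* m :* t := con 2 :* ((t :+ u) :* m)) refl m t u ⟩
    2 * ((t + u) * m)           ≡⟨ cong (λ k → 2 * (k * m)) t+u≡n ⟩
    2 * (n * m)                 ∎)
    where
    2t<qu : 2 * t < ⌊2r⌋ * u
    2t<qu = ℕ.+-cancelˡ-< (t * ⌊2r⌋) _ _ (begin-strict
      t * ⌊2r⌋ + 2 * t             ≡⟨ solve 2 (λ t q → t :* q :+ con 2 :* t := t :* (con 2 :+ q)) refl t ⌊2r⌋ ⟩
      t * (2 + ⌊2r⌋)               <⟨ lt ⟩
      ⌊2r⌋ * n                     ≡⟨ cong (⌊2r⌋ *_) t+u≡n ⟨
      ⌊2r⌋ * (t + u)               ≡⟨ solve 3 (λ t q u → q :* (t :+ u) := t :* q :+ q :* u) refl t ⌊2r⌋ u ⟩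
      t * ⌊2r⌋ + ⌊2r⌋ * u             ∎)

  -- With numerator 2m, rounding 2r up only enlarges the denominator 2r + 2, and 2m / (2r + 2) is mn
  -- / (m + n).
  ceil-case : ∀ t → t * (2 + ⌈2r⌉) < 2 * m → t * (m + n) < n * m
  ceil-case t lt = ℕ.*-cancelˡ-< 2 _ _ (begin-strict
    2 * (t * (m + n))           ≡⟨ solve 3 (λ t m n → con 2 :* (t :* (m :+ n)) := t :* (con 2 :* m) :+ con 2 :* t :* n) refl t m n ⟩
    t * (2 * m) + 2 * t * n     ≤⟨ ℕ.+-monoˡ-≤ (2 * t * n) (ℕ.*-monoʳ-≤ t (≤-⌈/⌉* (2 * m) n)) ⟩
    t * (⌈2r⌉ * n) + 2 * t * n     ≡⟨ solve 3 (λ t q n → t :* (q :* n) :+ con 2 :* t :* n := t :* (con 2 :+ q) :* n) refl t ⌈2r⌉ n ⟩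
    t * (2 + ⌈2r⌉) * n             <⟨ ℕ.*-monoˡ-< n lt ⟩
    2 * m * n                   ≡⟨ solve 2 (λ m n → con 2 :* m :* n := con 2 :* (n :* m)) refl m n ⟩
    2 * (n * m)                 ∎)
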